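{- Let $L$ be a countably infinite set and consider the edgeless cube $Q_L$. Every legal configuration accessible from $f_{\mathrm{solved}}$ can be solved in at most $\omega^2$ many moves: for each such configuration $f$ there is a basic sequence of length at most $\omega^2$ which, applied to $f$, has terminal configuration $f_{\mathrm{solved}}$.
   Context: Let $L$ be an infinite set, $-L=\{ -r:r\in L\}$ a disjoint copy of $L$, and $0$ a new element; $L^\dagger=-L\cup\{0\}\cup L$ with $-(-r)=r$, $-0=0$. Adjoin $\pm\infty$ with $-(+\infty)=-\infty$ and set $\bar L^\dagger=L^\dagger\cup\{\pm\infty\}$. Points of $U=(\bar L^\dagger)^3$ have coordinates $x,y,z$. The edgeless cube $Q_L$ is the set of cells: points of $U$ with exactly one coordinate in $\{\pm\infty\}$. For $i\in\{x,y,z\}$, $\alpha\in\bar L^\dagger$, the quarter-turn twist $T_{i,\alpha}$ is the permutation of cells fixing every cell $p$ with $p_i\ne\alpha$ and acting on the others by $T_{x,\alpha}(\alpha,y,z)=(\alpha,-z,y)$, $T_{y,\alpha}(x,\alpha,z)=(z,\alpha,-x)$, $T_{z,\alpha}(x,y,\alpha)=(-y,x,\alpha)$ (so a face twist $T_{i,\pm\infty}$ moves only cells of that face). Basic twists are $T,T^2,T^3$ for quarter-turn twists $T$. A basic sequence is a sequence $\langle\sigma_\eta:\eta<\theta\rangle$ of basic twists of ordinal length $\theta$. A configuration is a map $f$ from cells to the six colors red, white, green, orange, yellow, blue together with a special value NaC; it is legal if it never takes value NaC. The solved configuration $f_{\mathrm{solved}}$ colors a cell red, blue, white, orange, green, yellow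 according as $x=+\infty$, $y=+\infty$, $z=+\infty$, $x=-\infty$, $y=-\infty$, $z=-\infty$. A twist $\sigma$ acts by $(\sigma f)(c)=f(\sigma^{ -1}c)$. Applying $\langle\sigma_\eta:\eta<\theta\rangle$ to $f_0$ produces $f_{\eta+1}=\sigma_\eta f_\eta$, and for limit $\lambda\le\theta$, $f_\lambda(c)$ is the eventually constant value of $f_\eta(c)$ ($\eta<\lambda$) if it exists and NaC otherwise; $f_\theta$ is the terminal configuration. $f$ is accessible from $f_0$ if it is the terminal configuration of some basic sequence applied to $f_0$. -}

module Defs where

open import Level using (Level; 0ℓ; _⊔_) renaming (suc to lsuc)
open import Data.Nat.Base as ℕ using (ℕ)
import Data.Nat.Induction as ℕ
import Data.Nat.Properties as ℕ
open import Data.Product.Base using (Σ-syntax; ∃; ∃-syntax; _×_; _,_)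
open import Data.Product.Properties using (×-≡,≡→≡)
open import Data.Product.Relation.Binary.Lex.Strict
  using (×-Lex; ×-wellFounded; ×-isStrictTotalOrder)
open import Data.Sign.Base using (Sign; +; -; opposite)
import Data.Sign.Properties as Sign
open import Function.Base using (_∘_)
open import Function.Bundles using (_↔_; _⤖_; mk↔ₛ′; module Inverse; module Bijection)
open import Function.Construct.Composition using (_↔-∘_)
open import Induction.WellFounded using (WellFounded)
open import Relation.Binary.Core using (Rel)
open import Relation.Binary.Definitions using (DecidableEquality; Trichotomous; tri<; tri≈; tri>)
open import Relation.Binary.PropositionalEquality
  using (_≡_; _≢_; _≗_; refl; trans; cong; isEquivalence)
open import Relation.Binary.Structures using (IsStrictTotalOrder)
open import Relation.Binary.Structures.Biased using (isStrictTotalOrderᶜ)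
import Relation.Binary.Construct.Add.Supremum.Strict as AddSupremum
open import Relation.Nullary.Construct.Add.Supremum using (_⁺; ⊤⁺; [_])
open import Relation.Nullary.Decidable.Core using (yes; no; map′)
open import Relation.Nullary.Decidable using (via-injection)
open import Relation.Nullary.Negation.Core using (¬_; contradiction)

private
  variable
    o r o′ r′ : Level

-- Ordinals are represented by well-ordered types.

record Ordinal (o r : Level) : Set (lsuc (o ⊔ r)) where
  field
    Carrier            : Set o
    _<_                : Rel Carrier r
    isStrictTotalOrder : IsStrictTotalOrder _≡_ _<_
    wellFounded        : WellFounded _<_

infix 4 _≼_

-- θ ≼ θ′ holds when θ is order-isomorphic to an initial segment of θ′.

record _≼_ (θ : Ordinal o r) (θ′ : Ordinal o′ r′) : Set (o ⊔ r ⊔ o′ ⊔ r′) where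
  private
    module θ  = Ordinal θ
    module θ′ = Ordinal θ′
  field
    to       : θ.Carrier → θ′.Carrier
    monotone : ∀ {x y} → x θ.< y → to x θ′.< to y
    initial  : ∀ {x y} → y θ′.< to x → ∃[ x′ ] x′ θ.< x × to x′ ≡ y

ω² : Ordinal 0ℓ 0ℓ
ω² = record
  { Carrier            = ℕ × ℕ
  ; _<_                = ×-Lex _≡_ ℕ._<_ ℕ._<_
  ; isStrictTotalOrder = isStrictTotalOrderᶜ record
    { isEquivalence = isEquivalence
    ; trans         = λ {i} {j} {k} → Lex.trans {i} {j} {k}
    ; compare       = compare
    }
  ; wellFounded        = ×-wellFounded ℕ.<-wellFounded ℕ.<-wellFounded
  }
  where
  module Lex = IsStrictTotalOrder
    (×-isStrictTotalOrder ℕ.<-isStrictTotalOrder ℕ.<-isStrictTotalOrder)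
  compare : Trichotomous _≡_ (×-Lex _≡_ ℕ._<_ ℕ._<_)
  compare p q with Lex.compare p q
  ... | tri< a b c = tri< a (λ { refl → b (refl , refl) }) c
  ... | tri≈ a b c = tri≈ a (×-≡,≡→≡ b) c
  ... | tri> a b c = tri> a (λ { refl → b (refl , refl) }) c

-- The elements of θ are the ordinals below its order type and ⊤⁺ is the order
-- type itself, so Stage θ consists of the ordinals η ≤ θ.

module Stages (θ : Ordinal o r) where
  open Ordinal θ
  open AddSupremum _<_ public using (_<⁺_)

  Stage : Set o
  Stage = Carrier ⁺

  IsZero : Stage → Set (o ⊔ r)
  IsZero η = ∀ ζ → ¬ ζ <⁺ η

  IsSuccessorOf : Carrier → Stage → Set (o ⊔ r)
  IsSuccessorOf ζ η = [ ζ ] <⁺ η × (∀ ξ → ¬ ([ ζ ] <⁺ ξ × ξ <⁺ η))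

  IsLimit : Stage → Set (o ⊔ r)
  IsLimit η = ¬ IsZero η × (∀ ζ → ζ <⁺ η → ∃[ ξ ] ζ <⁺ ξ × ξ <⁺ η)

data Colour : Set where
  red white green orange yellow blue : Colour

data Value : Set where
  colour : Colour → Value
  NaC    : Value

data Axis : Set where
  x-axis y-axis z-axis : Axis

-- Twists test coordinates for equality, hence the decision procedure.

module Cube {ℓ} (L : Set ℓ) (_≟_ : DecidableEquality L) where

  -- signed + r is the element r of L, and signed - r is its copy -r.

  data L† : Set ℓ where
    signed : Sign → L → L†
    0†     : L†

  data L̄† : Set ℓ where
    fin : L† → L̄†
    ∞   : Sign → L̄†

  neg† : L† → L†
  neg† (signed s a) = signed (opposite s) a
  neg† 0†           = 0†

  neg : L̄† → L̄†
  neg (fin a) = fin (neg† a)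
  neg (∞ s)   = ∞ (opposite s)

  record Point : Set ℓ where
    constructor ⟨_,_,_⟩
    field
      x y z : L̄†

  coordinate : Axis → Point → L̄†
  coordinate x-axis = Point.x
  coordinate y-axis = Point.y
  coordinate z-axis = Point.z

  data ExactlyOneInfinite : Point → Set ℓ where
    only-x : ∀ s b c → ExactlyOneInfinite ⟨ ∞ s , fin b , fin c ⟩
    only-y : ∀ a s c → ExactlyOneInfinite ⟨ fin a , ∞ s , fin c ⟩
    only-z : ∀ a b s → ExactlyOneInfinite ⟨ fin a , fin b , ∞ s ⟩

  record Cell : Set ℓ where
    constructor cell
    field
      point  : Point
      isCell : ExactlyOneInfinite point
  open Cell public

  irrelevant : ∀ {p} (u v : ExactlyOneInfinite p) → u ≡ v
  irrelevant (only-x s b c) (only-x .s .b .c) = refl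
  irrelevant (only-y a s c) (only-y .a .s .c) = refl
  irrelevant (only-z a b s) (only-z .a .b .s) = refl

  cell-≡ : ∀ {c d} → point c ≡ point d → c ≡ d
  cell-≡ {cell p u} {cell .p v} refl = cong (cell p) (irrelevant u v)

  neg-involutive : ∀ a → neg (neg a) ≡ a
  neg-involutive (fin (signed + a)) = refl
  neg-involutive (fin (signed - a)) = refl
  neg-involutive (fin 0†)           = refl
  neg-involutive (∞ +)              = refl
  neg-involutive (∞ -)              = refl

  _≟†_ : DecidableEquality L†
  signed s a ≟† signed t b with s Sign.≟ t | a ≟ b
  ... | yes refl | yes refl = yes refl
  ... | no s≢t   | _        = no λ { refl → s≢t refl }
  ... | yes _    | no a≢b   = no λ { refl → a≢b refl }
  signed _ _ ≟† 0†         = no λ ()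
  0†         ≟† signed _ _ = no λ ()
  0†         ≟† 0†         = yes refl

  _≟̄_ : DecidableEquality L̄†
  fin a ≟̄ fin b = map′ (cong fin) (λ { refl → refl }) (a ≟† b)
  fin _ ≟̄ ∞ _   = no λ ()
  ∞ _   ≟̄ fin _ = no λ ()
  ∞ s   ≟̄ ∞ t   = map′ (cong ∞) (λ { refl → refl }) (s Sign.≟ t)

  turn : Axis → Point → Point
  turn x-axis ⟨ x , y , z ⟩ = ⟨ x , neg z , y ⟩
  turn y-axis ⟨ x , y , z ⟩ = ⟨ z , y , neg x ⟩
  turn z-axis ⟨ x , y , z ⟩ = ⟨ neg y , x , z ⟩

  turn⁻¹ : Axis → Point → Point
  turn⁻¹ x-axis ⟨ x , y , z ⟩ = ⟨ x , z , neg y ⟩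
  turn⁻¹ y-axis ⟨ x , y , z ⟩ = ⟨ neg z , y , x ⟩
  turn⁻¹ z-axis ⟨ x , y , z ⟩ = ⟨ y , neg x , z ⟩

  turn-isCell : ∀ i {p} → ExactlyOneInfinite p → ExactlyOneInfinite (turn i p)
  turn-isCell x-axis (only-x s b c) = only-x _ _ _
  turn-isCell x-axis (only-y a s c) = only-z _ _ _
  turn-isCell x-axis (only-z a b s) = only-y _ _ _
  turn-isCell y-axis (only-x s b c) = only-z _ _ _
  turn-isCell y-axis (only-y a s c) = only-y _ _ _
  turn-isCell y-axis (only-z a b s) = only-x _ _ _
  turn-isCell z-axis (only-x s b c) = only-y _ _ _
  turn-isCell z-axis (only-y a s c) = only-x _ _ _
  turn-isCell z-axis (only-z a b s) = only-z _ _ _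

  turn⁻¹-isCell : ∀ i {p} → ExactlyOneInfinite p → ExactlyOneInfinite (turn⁻¹ i p)
  turn⁻¹-isCell x-axis (only-x s b c) = only-x _ _ _
  turn⁻¹-isCell x-axis (only-y a s c) = only-z _ _ _
  turn⁻¹-isCell x-axis (only-z a b s) = only-y _ _ _
  turn⁻¹-isCell y-axis (only-x s b c) = only-z _ _ _
  turn⁻¹-isCell y-axis (only-y a s c) = only-y _ _ _
  turn⁻¹-isCell y-axis (only-z a b s) = only-x _ _ _
  turn⁻¹-isCell z-axis (only-x s b c) = only-y _ _ _
  turn⁻¹-isCell z-axis (only-y a s c) = only-x _ _ _
  turn⁻¹-isCell z-axis (only-z a b s) = only-z _ _ _

  turn-turn⁻¹ : ∀ i p → turn i (turn⁻¹ i p) ≡ p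
  turn-turn⁻¹ x-axis ⟨ x , y , z ⟩ = cong (λ v → ⟨ x , v , z ⟩) (neg-involutive y)
  turn-turn⁻¹ y-axis ⟨ x , y , z ⟩ = cong (λ v → ⟨ x , y , v ⟩) (neg-involutive z)
  turn-turn⁻¹ z-axis ⟨ x , y , z ⟩ = cong (λ v → ⟨ v , y , z ⟩) (neg-involutive x)

  turn⁻¹-turn : ∀ i p → turn⁻¹ i (turn i p) ≡ p
  turn⁻¹-turn x-axis ⟨ x , y , z ⟩ = cong (λ v → ⟨ x , y , v ⟩) (neg-involutive z)
  turn⁻¹-turn y-axis ⟨ x , y , z ⟩ = cong (λ v → ⟨ v , y , z ⟩) (neg-involutive x)
  turn⁻¹-turn z-axis ⟨ x , y , z ⟩ = cong (λ v → ⟨ x , v , z ⟩) (neg-involutive y)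

  turn-coordinate : ∀ i p → coordinate i (turn i p) ≡ coordinate i p
  turn-coordinate x-axis p = refl
  turn-coordinate y-axis p = refl
  turn-coordinate z-axis p = refl

  turn⁻¹-coordinate : ∀ i p → coordinate i (turn⁻¹ i p) ≡ coordinate i p
  turn⁻¹-coordinate x-axis p = refl
  turn⁻¹-coordinate y-axis p = refl
  turn⁻¹-coordinate z-axis p = refl

  turnCell turnCell⁻¹ : Axis → Cell → Cell
  turnCell   i (cell p u) = cell (turn   i p) (turn-isCell   i u)
  turnCell⁻¹ i (cell p u) = cell (turn⁻¹ i p) (turn⁻¹-isCell i u)

  onSlice : Axis → L̄† → (Cell → Cell) → Cell → Cell
  onSlice i α g c with coordinate i (point c) ≟̄ α
  ... | yes _ = g c
  ... | no  _ = c

  onSlice-inverse : ∀ i α (g h : Cell → Cell) →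
    (∀ c → coordinate i (point (h c)) ≡ coordinate i (point c)) →
    (∀ c → g (h c) ≡ c) →
    ∀ c → onSlice i α g (onSlice i α h c) ≡ c
  onSlice-inverse i α g h h-coord gh c with coordinate i (point c) ≟̄ α
  ... | yes p with coordinate i (point (h c)) ≟̄ α
  ...   | yes _ = gh c
  ...   | no ¬q = contradiction (trans (h-coord c) p) ¬q
  onSlice-inverse i α g h h-coord gh c | no ¬p with coordinate i (point c) ≟̄ α
  ...   | yes q = contradiction q ¬p
  ...   | no  _ = refl

  quarterTurn : Axis → L̄† → Cell ↔ Cell
  quarterTurn i α = mk↔ₛ′ (onSlice i α (turnCell i)) (onSlice i α (turnCell⁻¹ i))
    (onSlice-inverse i α (turnCell i) (turnCell⁻¹ i)
      (turn⁻¹-coordinate i ∘ point) (λ c → cell-≡ (turn-turn⁻¹ i (point c))))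
    (onSlice-inverse i α (turnCell⁻¹ i) (turnCell i)
      (turn-coordinate i ∘ point) (λ c → cell-≡ (turn⁻¹-turn i (point c))))

  data BasicTwist : Set ℓ where
    T T² T³ : Axis → L̄† → BasicTwist

  permutation : BasicTwist → Cell ↔ Cell
  permutation (T  i α) = quarterTurn i α
  permutation (T² i α) = quarterTurn i α ↔-∘ quarterTurn i α
  permutation (T³ i α) = quarterTurn i α ↔-∘ (quarterTurn i α ↔-∘ quarterTurn i α)

  Configuration : Set ℓ
  Configuration = Cell → Value

  Legal : Configuration → Set ℓ
  Legal f = ∀ c → f c ≢ NaC

  solved : Configuration
  solved (cell _ (only-x + _ _)) = colour red
  solved (cell _ (only-x - _ _)) = colour orange
  solved (cell _ (only-y _ + _)) = colour blue
  solved (cell _ (only-y _ - _)) = colour green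
  solved (cell _ (only-z _ _ +)) = colour white
  solved (cell _ (only-z _ _ -)) = colour yellow

  twist : BasicTwist → Configuration → Configuration
  twist σ f c = f (Inverse.from (permutation σ) c)

  BasicSequence : Ordinal o r → Set (ℓ ⊔ o)
  BasicSequence θ = Ordinal.Carrier θ → BasicTwist

  module _ (θ : Ordinal o r) where
    open Stages θ

    -- From some stage below η onwards, the cell c has value v.

    Eventually : (Stage → Configuration) → Stage → Cell → Value → Set (o ⊔ r)
    Eventually f η c v =
      ∃[ ζ ] ζ <⁺ η × f ζ c ≡ v × (∀ ξ → ζ <⁺ ξ → ξ <⁺ η → f ξ c ≡ v)

    -- Run θ σ f₀ f states that f is the terminal configuration of the basic
    -- sequence σ applied to f₀; configurations are compared cell by cell.

    record Run (σ : BasicSequence θ) (f₀ f : Configuration) : Set (ℓ ⊔ o ⊔ r) where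
      field
        at        : Stage → Configuration
        zero      : ∀ η → IsZero η → at η ≗ f₀
        successor : ∀ ζ η → IsSuccessorOf ζ η → at η ≗ twist (σ ζ) (at [ ζ ])
        limit     : ∀ η → IsLimit η → ∀ c v → Eventually at η c v → at η c ≡ v
        limit-NaC : ∀ η → IsLimit η → ∀ c → ¬ ∃ (Eventually at η c) → at η c ≡ NaC
        terminal  : at ⊤⁺ ≗ f

  Accessible : (o r : Level) → Configuration → Configuration → Set (ℓ ⊔ lsuc (o ⊔ r))
  Accessible o r f₀ f =
    Σ[ θ ∈ Ordinal o r ] Σ[ σ ∈ BasicSequence θ ] Run θ σ f₀ f

countable⇒≟ : ∀ {ℓ} {L : Set ℓ} → L ⤖ ℕ → DecidableEquality L
countable⇒≟ L⤖ℕ = via-injection (Bijection.injection L⤖ℕ) ℕ._≟_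

{-# OPTIONS --safe #-}
module Submission where

-- Unless b = c = 0, the cluster of a cell (∞ , b , c) consists of its 24 images under
-- rotations. No NaC ever disappears, so an accessible legal configuration is, on each cluster,
-- a finite word away from the solved one. In particular a finite word solves the six centres.
--
-- A slab, that is a set D of parallel slices, can be turned as a whole in ω moves. If A turns
-- the slice b, B the slab D and F a face, then [[A , B] , F] is a 3-cycle on each cluster
-- (∞ , b , c) with c ∈ D and fixes all other cells. Such 3-cycles generate all 3-cycles of the
-- 24 positions, and every transposition has the effect of a 3-cycle on colours because no
-- colour occurs only once. As 24 cells have only finitely many colourings, finitely many slab
-- turns solve the clusters (∞ , b , c) for all c at once.
--
-- This is done for b = 0 , ℓ₀ , ℓ₁ , … in turn, where c only runs through elements not treated
-- before. From some point on a cell is then moved by face twists only, and these do not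
-- change the colours of a face that is solved.

open import Defs
open import Axiom.ExcludedMiddle using (ExcludedMiddle)
open import Data.Bool.Base using (Bool; true; false; _∧_; not; if_then_else_)
open import Data.Empty using (⊥)
open import Data.List.Base using (List; []; _∷_; _++_; map; cartesianProductWith)
open import Data.List.Membership.Propositional using (_∈_)
open import Data.List.Membership.Propositional.Properties using (∈-cartesianProductWith⁺)
open import Data.List.Relation.Unary.All as All using (All; []; _∷_)
import Data.List.Relation.Unary.All.Properties as All
open import Data.List.Relation.Unary.Any as Any using (Any; here; there)
import Data.List.Relation.Unary.Any.Properties as Any
open import Data.Nat.Base as ℕ using (ℕ; zero; suc; z≤n; s≤s)
import Data.Nat.Properties as ℕ
open import Data.Product.Base
  using (Σ-syntax; ∃; ∃-syntax; _×_; _,_; proj₁; proj₂; map₁; map₂)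
open import Data.Sign.Base using (Sign; +; -; opposite; _*_)
import Data.Sign.Properties as Sign
open import Data.Sum.Base using (_⊎_; inj₁; inj₂; fromInj₂)
open import Function.Base using (id; _∘_; const; _$_)
open import Function.Bundles using (_⤖_; _↔_; mk↔ₛ′; module Inverse; module Bijection)
open import Function.Construct.Composition using (_↔-∘_)
open import Function.Properties.Bijection using (⤖⇒↔)
open import Induction.WellFounded as WF using (WellFounded; Acc; acc)
open import Level using (0ℓ; _⊔_)
open import Relation.Binary.Construct.Add.Supremum.Strict
  using ([_]; [_]<⊤⁺; <⁺-trans; <⁺-cmp-≡)
open import Relation.Binary.Definitions
  using (DecidableEquality; Trichotomous; tri<; tri≈; tri>)
open import Relation.Binary.PropositionalEquality
  using (_≡_; _≢_; _≗_; refl; sym; trans; cong; cong₂; subst; ≢-sym; module ≡-Reasoning)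
open import Relation.Binary.Structures using (module IsStrictTotalOrder)
open import Relation.Nullary.Construct.Add.Supremum using (⊤⁺; [_])
open import Relation.Nullary.Decidable using (Dec; yes; no; does; dec-true; dec-false)
open import Relation.Nullary.Negation.Core using (¬_; contradiction)

-- The obstacle is convergence at limit stages. A 3-cycle displaces many cells before it restores
-- them, so treating the clusters (∞ , b , c) one c at a time would turn the slice b infinitely
-- often, and nothing would make its cells converge. With slabs, all c are served by finitely many
-- turns, after which the slice b is never turned again. Each b thus costs finitely many blocks of
-- length ω, and all of them together cost ω².
--
-- Repeated colours settle a parity problem. A quarter turn permutes the cells of a cluster that it
-- moves in 4-cycles, so the permutation accumulated on a cluster may be odd, with a parity that
-- varies from cluster to cluster, while 3-cycles are even. Exchanging two cells of the same colour
-- is invisible and repairs the parity.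

-- The order of stages

module StageProperties {o r} (θ : Ordinal o r) where
  open Ordinal θ
  open Stages θ

  <⁺-transitive : ∀ {η ζ ξ} → η <⁺ ζ → ζ <⁺ ξ → η <⁺ ξ
  <⁺-transitive = <⁺-trans _<_ (IsStrictTotalOrder.trans isStrictTotalOrder)

  <⁺-compare : Trichotomous _≡_ _<⁺_
  <⁺-compare = <⁺-cmp-≡ _<_ (IsStrictTotalOrder.compare isStrictTotalOrder)

  private
    accessible : ∀ {k} → Acc _<_ k → Acc _<⁺_ [ k ]
    accessible (acc rs) = acc λ { [ l<k ] → accessible (rs l<k) }

  <⁺-wellFounded : WellFounded _<⁺_
  <⁺-wellFounded [ k ] = accessible (wellFounded k)
  <⁺-wellFounded ⊤⁺    = acc λ { [ k ]<⊤⁺ → accessible (wellFounded k) }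

  common-bound : ∀ {η} → IsLimit η → ∀ {ζ ζ′} → ζ <⁺ η → ζ′ <⁺ η →
    ∃[ ξ ] ζ <⁺ ξ × ζ′ <⁺ ξ × ξ <⁺ η
  common-bound (_ , dense) {ζ} {ζ′} ζ<η ζ′<η with <⁺-compare ζ ζ′
  ... | tri≈ _ refl _ = let ξ , ζ<ξ , ξ<η = dense ζ ζ<η in ξ , ζ<ξ , ζ<ξ , ξ<η
  ... | tri< ζ<ζ′ _ _ = let ξ , ζ′<ξ , ξ<η = dense ζ′ ζ′<η in
    ξ , <⁺-transitive ζ<ζ′ ζ′<ξ , ζ′<ξ , ξ<η
  ... | tri> _ _ ζ′<ζ = let ξ , ζ<ξ , ξ<η = dense ζ ζ<η in
    ξ , ζ<ξ , <⁺-transitive ζ′<ζ ζ<ξ , ξ<η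

-- Slab turns and clusters

next prev : Axis → Axis
next x-axis = y-axis
next y-axis = z-axis
next z-axis = x-axis
prev x-axis = z-axis
prev y-axis = x-axis
prev z-axis = y-axis

data Relative (i : Axis) : Axis → Set where
  same   : Relative i i
  after  : Relative i (next i)
  before : Relative i (prev i)

relative : ∀ i j → Relative i j
relative x-axis x-axis = same
relative x-axis y-axis = after
relative x-axis z-axis = before
relative y-axis x-axis = before
relative y-axis y-axis = same
relative y-axis z-axis = after
relative z-axis x-axis = after
relative z-axis y-axis = before
relative z-axis z-axis = same

-- frame i o s t stands for the rotated image of the cell (∞ , b , c) with ∞ s on axis i and
-- t · c on one of the other two axes. The remaining axis, which is next i when o is +,
-- carries b with the sign that the rotation dictates.

record Frame : Set where
  constructor frame
  field
    axis  : Axis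
    order : Sign
    side  : Sign
    sign  : Sign

-- The quarter turns about the frame's own axis, the next one and the previous one. Each is an odd
-- permutation of the coordinates and therefore flips `order`, which later shows that the image
-- differs from the frame.
spinF spinG spinH : Frame → Frame
spinF (frame i + s t) = frame i - s t
spinF (frame i - s t) = frame i + s (opposite t)
spinG (frame i + s t) = frame (prev i) - s (opposite t)
spinG (frame i - s t) = frame (prev i) + s t
spinH (frame i o s t) = frame (next i) (opposite o) (opposite s) t

does-sound : ∀ {p} {P : Set p} (p? : Dec P) → does p? ≡ true → P
does-sound (yes p) _ = p

module Slabs {ℓ} (L : Set ℓ) (_≟_ : DecidableEquality L) where
  open Cube L _≟_

  infixl 8 _!_
  _!_ : Cell → Axis → L̄†
  c ! i = coordinate i (point c)

  -- The sign + is the inverse turn because a twist acts on configurations by precomposition with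
  -- its inverse.
  spin : Sign → Axis → Cell → Cell
  spin + = turnCell⁻¹
  spin - = turnCell

  spin-coordinate : ∀ d i c → spin d i c ! i ≡ c ! i
  spin-coordinate + i c = turn⁻¹-coordinate i (point c)
  spin-coordinate - i c = turn-coordinate i (point c)

  spin-opposite : ∀ d i c → spin d i (spin (opposite d) i c) ≡ c
  spin-opposite + i c = cell-≡ (turn⁻¹-turn i (point c))
  spin-opposite - i c = cell-≡ (turn-turn⁻¹ i (point c))

  -- The letter (d , i , E) turns all slices α with E α about the axis i simultaneously. A
  -- word w acts on a configuration g by g ∘ pull w, so + stands for T and - for T³.

  Letter : Set ℓ
  Letter = Sign × Axis × (L̄† → Bool)

  Word : Set ℓ
  Word = List Letter

  abstract
    move : Letter → Cell → Cell
    move (d , i , E) c = if E (c ! i) then spin d i c else c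

    move-in : ∀ d i E c → E (c ! i) ≡ true → move (d , i , E) c ≡ spin d i c
    move-in d i E c e rewrite e = refl

    move-out : ∀ d i E c → E (c ! i) ≡ false → move (d , i , E) c ≡ c
    move-out d i E c e rewrite e = refl

  pull : Word → Cell → Cell
  pull []      c = c
  pull (l ∷ w) c = move l (pull w c)

  move-coordinate : ∀ d i E c → move (d , i , E) c ! i ≡ c ! i
  move-coordinate d i E c with E (c ! i) in eq
  ... | true  = trans (cong (_! i) (move-in d i E c eq)) (spin-coordinate d i c)
  ... | false = cong (_! i) (move-out d i E c eq)

  flip : Letter → Letter
  flip (d , r) = opposite d , r

  move-flip : ∀ l c → move l (move (flip l) c) ≡ c
  move-flip (d , i , E) c with E (c ! i) in eq
  ... | true  = trans (cong (move (d , i , E)) (move-in (opposite d) i E c eq)) (trans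
    (move-in d i E _ (trans (cong E (spin-coordinate (opposite d) i c)) eq)) (spin-opposite d i c))
  ... | false = trans (cong (move (d , i , E)) (move-out (opposite d) i E c eq)) (move-out d i E c eq)

  flip-flip : ∀ l → flip (flip l) ≡ l
  flip-flip (d , r) = cong (_, r) (Sign.opposite-involutive d)

  inverse : Word → Word
  inverse []      = []
  inverse (l ∷ w) = inverse w ++ flip l ∷ []

  pull-++ : ∀ v w c → pull (v ++ w) c ≡ pull v (pull w c)
  pull-++ []      w c = refl
  pull-++ (l ∷ v) w c = cong (move l) (pull-++ v w c)

  pull-inverseʳ : ∀ w c → pull w (pull (inverse w) c) ≡ c
  pull-inverseʳ []      c = refl
  pull-inverseʳ (l ∷ w) c
    rewrite pull-++ (inverse w) (flip l ∷ []) c | pull-inverseʳ w (move (flip l) c) = move-flip l c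

  pull-inverseˡ : ∀ w c → pull (inverse w) (pull w c) ≡ c
  pull-inverseˡ []      c = refl
  pull-inverseˡ (l ∷ w) c
    rewrite pull-++ (inverse w) (flip l ∷ []) (move l (pull w c)) = trans
      (cong (pull (inverse w))
        (subst (λ k → move (flip l) (move k (pull w c)) ≡ pull w c) (flip-flip l)
          (move-flip (flip l) (pull w c))))
      (pull-inverseˡ w c)

  is : L̄† → L̄† → Bool
  is α β = does (β ≟̄ α)

  is-sound : ∀ α β → is α β ≡ true → β ≡ α
  is-sound α β = does-sound (β ≟̄ α)

  is-refl : ∀ α → is α α ≡ true
  is-refl α = dec-true (α ≟̄ α) refl

  is-≢ : ∀ {α β} → β ≢ α → is α β ≡ false
  is-≢ {α} {β} = dec-false (β ≟̄ α)

  single : Axis → L̄† → Letter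
  single i α = + , i , is α

  letters : BasicTwist → Word
  letters (T  i α) = single i α ∷ []
  letters (T² i α) = single i α ∷ single i α ∷ []
  letters (T³ i α) = single i α ∷ single i α ∷ single i α ∷ []

  onSlice-move : ∀ i α c → onSlice i α (turnCell⁻¹ i) c ≡ move (single i α) c
  onSlice-move i α c with (c ! i) ≟̄ α
  ... | yes p = sym (move-in + i (is α) c (trans (cong (is α) p) (is-refl α)))
  ... | no ¬p = sym (move-out + i (is α) c (is-≢ ¬p))

  back : BasicTwist → Cell → Cell
  back σ = Inverse.from (permutation σ)

  back-letters : ∀ σ c → back σ c ≡ pull (letters σ) c
  back-letters (T  i α) c = onSlice-move i α c
  back-letters (T² i α) c = trans (onSlice-move i α _) (cong (move (single i α)) (onSlice-move i α c))
  back-letters (T³ i α) c = trans (onSlice-move i α _) (cong (move (single i α)) (back-letters (T² i α) c))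

  infixr 7 _·_
  _·_ : Sign → L† → L†
  t · signed s a = signed (t * s) a
  t · 0†         = 0†

  neg-· : ∀ t v → neg† (t · v) ≡ opposite t · v
  neg-· + (signed s a) = refl
  neg-· - (signed s a) = cong (λ s′ → signed s′ a) (Sign.opposite-involutive s)
  neg-· t 0†           = refl

  -- faceCell i s v w has ∞ s on axis i, v on the next axis and w on the one after.

  faceCell : Axis → Sign → L† → L† → Cell
  faceCell x-axis s v w = cell _ (only-x s v w)
  faceCell y-axis s v w = cell _ (only-y w s v)
  faceCell z-axis s v w = cell _ (only-z v w s)

  data FaceView : Cell → Set ℓ where
    face : ∀ i s v w → FaceView (faceCell i s v w)

  faceView : ∀ c → FaceView c
  faceView (cell _ (only-x s b c)) = face x-axis s b c
  faceView (cell _ (only-y a s c)) = face y-axis s c a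
  faceView (cell _ (only-z a b s)) = face z-axis s a b

  face-axis : ∀ i {s v w} → faceCell i s v w ! i ≡ ∞ s
  face-axis x-axis = refl
  face-axis y-axis = refl
  face-axis z-axis = refl

  face-next : ∀ i {s v w} → faceCell i s v w ! next i ≡ fin v
  face-next x-axis = refl
  face-next y-axis = refl
  face-next z-axis = refl

  face-prev : ∀ i {s v w} → faceCell i s v w ! prev i ≡ fin w
  face-prev x-axis = refl
  face-prev y-axis = refl
  face-prev z-axis = refl

  faceCell-injective : ∀ i i′ {s s′ v v′ w w′} → faceCell i s v w ≡ faceCell i′ s′ v′ w′ →
    i ≡ i′ × s ≡ s′ × v ≡ v′ × w ≡ w′
  faceCell-injective x-axis x-axis refl = refl , refl , refl , refl
  faceCell-injective y-axis y-axis refl = refl , refl , refl , refl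
  faceCell-injective z-axis z-axis refl = refl , refl , refl , refl
  faceCell-injective x-axis y-axis ()
  faceCell-injective x-axis z-axis ()
  faceCell-injective y-axis x-axis ()
  faceCell-injective y-axis z-axis ()
  faceCell-injective z-axis x-axis ()
  faceCell-injective z-axis y-axis ()

  spin-same : ∀ i {s v w} → spin + i (faceCell i s v w) ≡ faceCell i s w (neg† v)
  spin-same x-axis = refl
  spin-same y-axis = refl
  spin-same z-axis = refl

  spin-next : ∀ i {s v w} → spin + (next i) (faceCell i s v w) ≡ faceCell (prev i) s (neg† w) v
  spin-next x-axis = refl
  spin-next y-axis = refl
  spin-next z-axis = refl

  spin-prev : ∀ i {s v w} → spin + (prev i) (faceCell i s v w) ≡ faceCell (next i) (opposite s) w v
  spin-prev x-axis = refl
  spin-prev y-axis = refl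
  spin-prev z-axis = refl

  solved-face : ∀ i {s v w v′ w′} → solved (faceCell i s v w) ≡ solved (faceCell i s v′ w′)
  solved-face x-axis {+} = refl
  solved-face x-axis { - } = refl
  solved-face y-axis {+} = refl
  solved-face y-axis { - } = refl
  solved-face z-axis {+} = refl
  solved-face z-axis { - } = refl

  spin-spin : ∀ i c → spin + i (spin + i (spin + i c)) ≡ spin - i c
  spin-spin x-axis (cell ⟨ x , y , z ⟩ _) =
    cell-≡ (cong₂ (λ v w → ⟨ x , v , w ⟩) refl (neg-involutive y))
  spin-spin y-axis (cell ⟨ x , y , z ⟩ _) =
    cell-≡ (cong₂ (λ v w → ⟨ w , y , v ⟩) refl (neg-involutive z))
  spin-spin z-axis (cell ⟨ x , y , z ⟩ _) =
    cell-≡ (cong₂ (λ v w → ⟨ v , w , z ⟩) refl (neg-involutive x))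

  module _ (b c : L†) where

    -- Rotations have determinant 1: the product of the three signs equals the parity of the order
    -- in which ∞ , b , c occupy the axes. This fixes the sign of b; the mirror images form the
    -- cluster of (∞ , b , -c).
    embed : Frame → Cell
    embed (frame i + s t) = faceCell i s ((s * t) · b) (t · c)
    embed (frame i - s t) = faceCell i s (t · c) (opposite (s * t) · b)

    private
      reface : ∀ {i s v w v′ w′} → v ≡ v′ → w ≡ w′ → faceCell i s v w ≡ faceCell i s v′ w′
      reface refl refl = refl

      sg : ∀ {u u′ v} → u ≡ u′ → u · v ≡ u′ · v
      sg refl = refl

      *-opposite : ∀ s t → s * opposite t ≡ opposite (s * t)
      *-opposite + + = refl
      *-opposite + - = refl
      *-opposite - + = refl
      *-opposite - - = refl

      opposite-* : ∀ s t → opposite s * t ≡ opposite (s * t)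
      opposite-* + + = refl
      opposite-* + - = refl
      opposite-* - + = refl
      opposite-* - - = refl

      opp² : ∀ {s} → opposite (opposite s) ≡ s
      opp² = Sign.opposite-involutive _

    spin-embed-F : ∀ m → spin + (Frame.axis m) (embed m) ≡ embed (spinF m)
    spin-embed-F (frame i + s t) = trans (spin-same i) (reface refl (neg-· _ b))
    spin-embed-F (frame i - s t) = trans (spin-same i) (reface (sg (sym (*-opposite s t))) (neg-· t c))

    spin-embed-G : ∀ m → spin + (next (Frame.axis m)) (embed m) ≡ embed (spinG m)
    spin-embed-G (frame i + s t) = trans (spin-next i)
      (reface (neg-· t c) (sg (sym (trans (cong opposite (*-opposite s t)) opp²))))
    spin-embed-G (frame i - s t) = trans (spin-next i) (reface (trans (neg-· _ b) (sg opp²)) refl)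

    spin-embed-H : ∀ m → spin + (prev (Frame.axis m)) (embed m) ≡ embed (spinH m)
    spin-embed-H (frame i + s t) = trans (spin-prev i)
      (reface refl (sg (sym (trans (cong opposite (opposite-* s t)) opp²))))
    spin-embed-H (frame i - s t) = trans (spin-prev i) (reface (sg (sym (opposite-* s t))) refl)

    spin+-embed : ∀ j m → ∃[ m′ ] spin + j (embed m) ≡ embed m′
    spin+-embed j m with relative (Frame.axis m) j
    ... | same   = spinF m , spin-embed-F m
    ... | after  = spinG m , spin-embed-G m
    ... | before = spinH m , spin-embed-H m

    spin-embed : ∀ d j m → ∃[ m′ ] spin d j (embed m) ≡ embed m′
    spin-embed + j m = spin+-embed j m
    spin-embed - j m with spin+-embed j m
    ... | m₁ , e₁ with spin+-embed j m₁
    ...   | m₂ , e₂ with spin+-embed j m₂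
    ...     | m₃ , e₃ = m₃ , (begin
      spin - j (embed m)                       ≡⟨ spin-spin j (embed m) ⟨
      spin + j (spin + j (spin + j (embed m))) ≡⟨ cong (λ x → spin + j (spin + j x)) e₁ ⟩
      spin + j (spin + j (embed m₁))           ≡⟨ cong (spin + j) e₂ ⟩
      spin + j (embed m₂)                      ≡⟨ e₃ ⟩
      embed m₃                                 ∎)
      where open ≡-Reasoning

    -- On a single cell a slab turn is either the identity or a rotation of the whole cube, so no
    -- word leads out of a cluster.
    pull-embed : ∀ w m → ∃[ m′ ] pull w (embed m) ≡ embed m′
    pull-embed []                m = m , refl
    pull-embed ((d , i , E) ∷ w) m with pull-embed w m
    ... | m₁ , e rewrite e with E (embed m₁ ! i) in eq
    ...   | true  rewrite move-in d i E (embed m₁) eq  = spin-embed d i m₁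
    ...   | false rewrite move-out d i E (embed m₁) eq = m₁ , refl

-- Commutators

data Distinct (i : Axis) : Axis → Axis → Set where
  cyclic     : Distinct i (next i) (prev i)
  anticyclic : Distinct i (prev i) (next i)

swap-distinct : ∀ {i j k} → Distinct i j k → Distinct i k j
swap-distinct cyclic     = anticyclic
swap-distinct anticyclic = cyclic

module Commutators {ℓ} (L : Set ℓ) (_≟_ : DecidableEquality L) where
  open Cube L _≟_
  open Slabs L _≟_

  data Infinite : L̄† → Set ℓ where
    infinite : ∀ s → Infinite (∞ s)

  neg-infinite : ∀ {α} → Infinite α → Infinite (neg α)
  neg-infinite (infinite s) = infinite (opposite s)

  infinite-unique : ∀ c {i j k} → Distinct i j k → Infinite (c ! i) → ¬ Infinite (c ! j)
  infinite-unique (cell _ (only-x _ _ _)) {x-axis} cyclic _ ()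
  infinite-unique (cell _ (only-x _ _ _)) {x-axis} anticyclic _ ()
  infinite-unique (cell _ (only-y _ _ _)) {y-axis} cyclic _ ()
  infinite-unique (cell _ (only-y _ _ _)) {y-axis} anticyclic _ ()
  infinite-unique (cell _ (only-z _ _ _)) {z-axis} cyclic _ ()
  infinite-unique (cell _ (only-z _ _ _)) {z-axis} anticyclic _ ()

  spin-infinite : ∀ d {i j k} → Distinct i j k → ∀ c → Infinite (c ! i) → Infinite (spin d j c ! k)
  spin-infinite + {x-axis} cyclic     _ p = p
  spin-infinite + {y-axis} cyclic     _ p = p
  spin-infinite + {z-axis} cyclic     _ p = p
  spin-infinite + {x-axis} anticyclic _ p = neg-infinite p
  spin-infinite + {y-axis} anticyclic _ p = neg-infinite p
  spin-infinite + {z-axis} anticyclic _ p = neg-infinite p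
  spin-infinite - {x-axis} cyclic     _ p = neg-infinite p
  spin-infinite - {y-axis} cyclic     _ p = neg-infinite p
  spin-infinite - {z-axis} cyclic     _ p = neg-infinite p
  spin-infinite - {x-axis} anticyclic _ p = p
  spin-infinite - {y-axis} anticyclic _ p = p
  spin-infinite - {z-axis} anticyclic _ p = p

  Finitary : (L̄† → Bool) → Set
  Finitary E = ∀ s → E (∞ s) ≡ false

  finitary : ∀ E {α} → Finitary E → Infinite α → E α ≡ false
  finitary E E-fin (infinite s) = E-fin s

  rotate-distinct : ∀ {i j k} → Distinct i j k → Distinct k i j
  rotate-distinct {x-axis} cyclic     = cyclic
  rotate-distinct {y-axis} cyclic     = cyclic
  rotate-distinct {z-axis} cyclic     = cyclic
  rotate-distinct {x-axis} anticyclic = anticyclic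
  rotate-distinct {y-axis} anticyclic = anticyclic
  rotate-distinct {z-axis} anticyclic = anticyclic

  commutator : Axis → (L̄† → Bool) → Axis → (L̄† → Bool) → Word
  commutator j E k E′ = (+ , j , E) ∷ (+ , k , E′) ∷ (- , j , E) ∷ (- , k , E′) ∷ []

  -- On the face i the commutator of the slabs E and E′ moves only the cells of both
  -- slabs: a cell that one of the turns takes off the face leaves the other slab.

  commutator-out : ∀ {i j k} → Distinct i j k → ∀ E E′ → Finitary E′ →
    ∀ c → Infinite (c ! i) → E′ (c ! k) ≡ false → pull (commutator j E k E′) c ≡ c
  commutator-out {j = j} {k} dist E E′ E′-fin c inf out
    rewrite move-out - k E′ c out
    with E (c ! j) in eq
  ... | false rewrite move-out - j E c eq | move-out + k E′ c out = move-out + j E c eq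
  ... | true
    rewrite move-in - j E c eq
          | move-out + k E′ (spin - j c) (finitary E′ E′-fin (spin-infinite - dist c inf)) = trans
      (move-in + j E _ (trans (cong E (spin-coordinate - j c)) eq)) (spin-opposite + j c)

  commutator-in : ∀ {i j k} → Distinct i j k → ∀ E E′ → Finitary E →
    ∀ c → Infinite (c ! i) → E′ (c ! k) ≡ true →
    pull (commutator j E k E′) c ≡ move (+ , j , E) c
  commutator-in {j = j} {k} dist E E′ E-fin c inf into
    rewrite move-in - k E′ c into
          | move-out - j E (spin - k c) (finitary E E-fin (spin-infinite - (swap-distinct dist) c inf))
          | move-in + k E′ (spin - k c) (trans (cong E′ (spin-coordinate - k c)) into)
          = cong (move (+ , j , E)) (spin-opposite + k c)

  module ThreeCycle {i j k} (dist : Distinct i j k) (s : Sign) (E E′ : L̄† → Bool)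
                    (E-finitary : Finitary E) (E′-finitary : Finitary E′) where

    -- The commutator `X` alone also acts on the opposite face. Off the face (i , s) the face turn
    -- does nothing, so `X` cancels against its conjugated inverse, except where `X⁻¹` brings a cell
    -- onto the face. On the face `X` moves only pivots and the conjugate of `X⁻¹` only their images
    -- under the face turn. What survives is one 3-cycle for each pivot.
    X X⁻¹ threeCycle : Word
    X   = commutator j E k E′
    X⁻¹ = commutator k E′ j E
    threeCycle = X ++ (+ , i , is (∞ s)) ∷ X⁻¹ ++ (- , i , is (∞ s)) ∷ []

    OnFace : Cell → Set ℓ
    OnFace c = c ! i ≡ ∞ s

    Pivot : Cell → Set ℓ
    Pivot c = OnFace c × E (c ! j) ≡ true × E′ (c ! k) ≡ true

    module _ (off : ∀ c → Pivot c → ¬ Pivot (spin + i c)) where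

      private
        F : Sign → Cell → Cell
        F d = move (d , i , is (∞ s))

        XX⁻¹ : ∀ c → pull X (pull X⁻¹ c) ≡ c
        XX⁻¹ = pull-inverseʳ X

        X⁻¹X : ∀ c → pull X⁻¹ (pull X c) ≡ c
        X⁻¹X = pull-inverseʳ X⁻¹

        onFace-infinite : ∀ c → OnFace c → Infinite (c ! i)
        onFace-infinite c p = subst Infinite (sym p) (infinite s)

        X-fix : ∀ c → OnFace c → ¬ Pivot c → pull X c ≡ c
        X-fix c p ¬q = go (E (c ! j)) (E′ (c ! k)) refl refl
          where
          go : ∀ u u′ → E (c ! j) ≡ u → E′ (c ! k) ≡ u′ → pull X c ≡ c
          go u     false e e′ = commutator-out dist E E′ E′-finitary c (onFace-infinite c p) e′
          go true  true  e e′ = contradiction (p , e , e′) ¬q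
          go false true  e e′ = trans
            (commutator-in dist E E′ E-finitary c (onFace-infinite c p) e′) (move-out + j E c e)

        X⁻¹-fix : ∀ c → OnFace c → ¬ Pivot c → pull X⁻¹ c ≡ c
        X⁻¹-fix c p ¬q = trans (cong (pull X⁻¹) (sym (X-fix c p ¬q))) (X⁻¹X c)

        X-pivot : ∀ c → Pivot c → pull X c ≡ spin + j c
        X-pivot c (p , e , e′) = trans
          (commutator-in dist E E′ E-finitary c (onFace-infinite c p) e′) (move-in + j E c e)

        X⁻¹-pivot : ∀ c → Pivot c → pull X⁻¹ c ≡ spin + k c
        X⁻¹-pivot c (p , e , e′) = trans
          (commutator-in (swap-distinct dist) E′ E E′-finitary c (onFace-infinite c p) e)
          (move-in + k E′ c e′)

        F-on : ∀ d c → OnFace c → F d c ≡ spin d i c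
        F-on d c p = move-in d i _ _ (trans (cong (is (∞ s)) p) (is-refl (∞ s)))

        F-off : ∀ d c → ¬ OnFace c → F d c ≡ c
        F-off d c ¬p = move-out d i _ _ (is-≢ ¬p)

        spin-onFace : ∀ d c → OnFace c → OnFace (spin d i c)
        spin-onFace d c p = trans (spin-coordinate d i c) p

        leave : ∀ c → Infinite (c ! k) → ¬ OnFace c
        leave c inf p = infinite-unique c (rotate-distinct dist) inf (onFace-infinite c p)

        leave′ : ∀ c → Infinite (c ! j) → ¬ OnFace c
        leave′ c inf p = infinite-unique c (rotate-distinct (swap-distinct dist)) inf (onFace-infinite c p)

        retreat : ∀ c → OnFace c → ¬ Pivot (spin - i c) →
          F + (pull X⁻¹ (F - c)) ≡ c
        retreat c p ¬q = begin
          F + (pull X⁻¹ (F - c))        ≡⟨ cong (λ x → F + (pull X⁻¹ x)) (F-on - c p) ⟩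
          F + (pull X⁻¹ (spin - i c))   ≡⟨ cong (F +) (X⁻¹-fix _ (spin-onFace - c p) ¬q) ⟩
          F + (spin - i c)              ≡⟨ F-on + _ (spin-onFace - c p) ⟩
          spin + i (spin - i c)         ≡⟨ spin-opposite + i c ⟩
          c                             ∎
          where open ≡-Reasoning

      threeCycle-pivot : ∀ c → Pivot c → pull threeCycle c ≡ spin + j c
      threeCycle-pivot c q@(p , _) =
        trans (cong (pull X) (retreat c p λ q⁻ → off (spin - i c) q⁻ (subst Pivot (sym (spin-opposite + i c)) q)))
              (X-pivot c q)

      threeCycle-spinʲ : ∀ c → Pivot c → pull threeCycle (spin + j c) ≡ spin + i c
      threeCycle-spinʲ c q@(p , _) = begin
        pull X (F + (pull X⁻¹ (F - (spin + j c)))) ≡⟨ cong (λ x → pull X (F + (pull X⁻¹ x)))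
                                                       (F-off - _ (leave (spin + j c) (spin-infinite + dist c
                                                         (onFace-infinite c p)))) ⟩
        pull X (F + (pull X⁻¹ (spin + j c)))       ≡⟨ cong (λ x → pull X (F + (pull X⁻¹ x))) (X-pivot c q) ⟨
        pull X (F + (pull X⁻¹ (pull X c)))         ≡⟨ cong (λ x → pull X (F + x)) (X⁻¹X c) ⟩
        pull X (F + c)                             ≡⟨ cong (pull X) (F-on + c p) ⟩
        pull X (spin + i c)                        ≡⟨ X-fix _ (spin-onFace + c p) (off c q) ⟩
        spin + i c                                 ∎
        where open ≡-Reasoning

      threeCycle-spinⁱ : ∀ c → Pivot c → pull threeCycle (spin + i c) ≡ c
      threeCycle-spinⁱ c q@(p , _) = begin
        pull X (F + (pull X⁻¹ (F - (spin + i c)))) ≡⟨ cong (λ x → pull X (F + (pull X⁻¹ x)))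
                                                       (F-on - _ (spin-onFace + c p)) ⟩
        pull X (F + (pull X⁻¹ (spin - i (spin + i c)))) ≡⟨ cong (λ x → pull X (F + (pull X⁻¹ x)))
                                                            (spin-opposite - i c) ⟩
        pull X (F + (pull X⁻¹ c))                  ≡⟨ cong (λ x → pull X (F + x)) (X⁻¹-pivot c q) ⟩
        pull X (F + (spin + k c))                  ≡⟨ cong (pull X) (F-off + _ (leave′ (spin + k c)
                                                       (spin-infinite + (swap-distinct dist) c
                                                         (onFace-infinite c p)))) ⟩
        pull X (spin + k c)                        ≡⟨ cong (pull X) (X⁻¹-pivot c q) ⟨
        pull X (pull X⁻¹ c)                        ≡⟨ XX⁻¹ c ⟩
        c                                          ∎
        where open ≡-Reasoning

      threeCycle-fix : (∀ c → Dec (Pivot c)) → ∀ x → ¬ Pivot x →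
        (∀ c → Pivot c → x ≢ spin + j c) → (∀ c → Pivot c → x ≢ spin + i c) →
        pull threeCycle x ≡ x
      threeCycle-fix pivot? x ¬q ¬j ¬i with (x ! i) ≟̄ ∞ s
      ... | yes p = trans
        (cong (pull X) (retreat x p (λ q⁻ → ¬i _ q⁻ (sym (spin-opposite + i x))))) (X-fix x p ¬q)
      ... | no ¬p = begin
        pull X (F + (pull X⁻¹ (F - x))) ≡⟨ cong (λ y → pull X (F + (pull X⁻¹ y))) (F-off - x ¬p) ⟩
        pull X (F + (pull X⁻¹ x))       ≡⟨ cong (pull X) (F-off + _ off-face) ⟩
        pull X (pull X⁻¹ x)             ≡⟨ XX⁻¹ x ⟩
        x                               ∎
        where
        open ≡-Reasoning
        off-face : ¬ OnFace (pull X⁻¹ x)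
        off-face p with pivot? (pull X⁻¹ x)
        ... | yes q = ¬j _ q (trans (sym (XX⁻¹ x)) (X-pivot _ q))
        ... | no ¬q′ = ¬p (subst OnFace (trans (sym (X-fix _ p ¬q′)) (XX⁻¹ x)) p)

-- Permutations generated by 3-cycles

module Cycles {x ρ} {X : Set x} (_≟_ : DecidableEquality X)
  (Realisable : (X → X) → Set ρ)
  (∘-realisable : ∀ {μ ν} → Realisable μ → Realisable ν → Realisable (μ ∘ ν)) where

  record Cycle (p q r : X) : Set (x ⊔ ρ) where
    field
      to         : X → X
      realisable : Realisable to
      p↦q        : to p ≡ q
      q↦r        : to q ≡ r
      r↦p        : to r ≡ p
      fixes      : ∀ {y} → y ≢ p → y ≢ q → y ≢ r → to y ≡ y
      p≢q        : p ≢ q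
      q≢r        : q ≢ r
      r≢p        : r ≢ p

    -- Makes `to ∘ to` the inverse, so that closure under composition alone is enough to realise
    -- inverses and conjugates.
    cubed : ∀ y → to (to (to y)) ≡ y
    cubed y with y ≟ p | y ≟ q | y ≟ r
    ... | yes refl | _        | _        = trans (cong (to ∘ to) p↦q) (trans (cong to q↦r) r↦p)
    ... | no _     | yes refl | _        = trans (cong (to ∘ to) q↦r) (trans (cong to r↦p) p↦q)
    ... | no _     | no _     | yes refl = trans (cong (to ∘ to) r↦p) (trans (cong to p↦q) q↦r)
    ... | no y≢p   | no y≢q   | no y≢r   = trans (cong (to ∘ to) fy) (trans (cong to fy) fy)
      where fy = fixes y≢p y≢q y≢r

    injective : ∀ {y z} → to y ≡ to z → y ≡ z
    injective {y} {z} e = trans (sym (cubed y)) (trans (cong (to ∘ to) e) (cubed z))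

  open Cycle

  cyc : X → X → X → X → X
  cyc p q r y with y ≟ p | y ≟ q | y ≟ r
  ... | yes _ | _     | _     = q
  ... | no _  | yes _ | _     = r
  ... | no _  | no _  | yes _ = p
  ... | no _  | no _  | no _  = y

  cyc-cycle : ∀ {p q r} → p ≢ q → q ≢ r → r ≢ p → Realisable (cyc p q r) → Cycle p q r
  cyc-cycle {p} {q} {r} p≢q q≢r r≢p real = record
    { to = cyc p q r ; realisable = real ; p↦q = first ; q↦r = second ; r↦p = third
    ; fixes = others ; p≢q = p≢q ; q≢r = q≢r ; r≢p = r≢p }
    where
    first : cyc p q r p ≡ q
    first with p ≟ p
    ... | yes _  = refl
    ... | no p≢p = contradiction refl p≢p
    second : cyc p q r q ≡ r
    second with q ≟ p | q ≟ q
    ... | yes q≡p | _      = contradiction (sym q≡p) p≢q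
    ... | no _    | yes _  = refl
    ... | no _    | no q≢q = contradiction refl q≢q
    third : cyc p q r r ≡ p
    third with r ≟ p | r ≟ q | r ≟ r
    ... | yes r≡p | _       | _      = contradiction r≡p r≢p
    ... | no _    | yes r≡q | _      = contradiction (sym r≡q) q≢r
    ... | no _    | no _    | yes _  = refl
    ... | no _    | no _    | no r≢r = contradiction refl r≢r
    others : ∀ {y} → y ≢ p → y ≢ q → y ≢ r → cyc p q r y ≡ y
    others {y} y≢p y≢q y≢r with y ≟ p | y ≟ q | y ≟ r
    ... | yes y≡p | _       | _       = contradiction y≡p y≢p
    ... | no _    | yes y≡q | _       = contradiction y≡q y≢q
    ... | no _    | no _    | yes y≡r = contradiction y≡r y≢r
    ... | no _    | no _    | no _    = refl

  rotate : ∀ {p q r} → Cycle p q r → Cycle q r p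
  rotate c = record
    { to = to c ; realisable = realisable c
    ; p↦q = q↦r c ; q↦r = r↦p c ; r↦p = p↦q c
    ; fixes = λ y≢q y≢r y≢p → fixes c y≢p y≢q y≢r
    ; p≢q = q≢r c ; q≢r = r≢p c ; r≢p = p≢q c
    }

  reverse : ∀ {p q r} → Cycle p q r → Cycle p r q
  reverse c = record
    { to = to c ∘ to c ; realisable = ∘-realisable (realisable c) (realisable c)
    ; p↦q = trans (cong (to c) (p↦q c)) (q↦r c)
    ; q↦r = trans (cong (to c) (r↦p c)) (p↦q c)
    ; r↦p = trans (cong (to c) (q↦r c)) (r↦p c)
    ; fixes = λ y≢p y≢r y≢q → let e = fixes c y≢p y≢q y≢r in trans (cong (to c) e) e
    ; p≢q = ≢-sym (r≢p c) ; q≢r = ≢-sym (q≢r c) ; r≢p = ≢-sym (p≢q c)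
    }

  swapped : ∀ {p q r} → Cycle p q r → Cycle q p r
  swapped c = reverse (rotate c)

  conjugate : ∀ {s t u p q r p′ q′ r′} (g : Cycle s t u) → Cycle p q r →
    to g p ≡ p′ → to g q ≡ q′ → to g r ≡ r′ → Cycle p′ q′ r′
  conjugate g c refl refl refl = record
    { to = to g ∘ to c ∘ to g ∘ to g
    ; realisable = ∘-realisable (realisable g) (∘-realisable (realisable c)
        (∘-realisable (realisable g) (realisable g)))
    ; p↦q = via (p↦q c) ; q↦r = via (q↦r c) ; r↦p = via (r↦p c)
    ; fixes = λ {y} y≢p y≢q y≢r → trans
        (cong (to g) (fixes c (move y≢p) (move y≢q) (move y≢r))) (cubed g y)
    ; p≢q = p≢q c ∘ injective g ; q≢r = q≢r c ∘ injective g ; r≢p = r≢p c ∘ injective g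
    }
    where
    via : ∀ {y z} → to c y ≡ z → to g (to c (to g (to g (to g y)))) ≡ to g z
    via {y} e = cong (to g) (trans (cong (to c) (cubed g y)) e)
    move : ∀ {y z} → y ≢ to g z → to g (to g y) ≢ z
    move {y} y≢ e = y≢ (trans (sym (cubed g y)) (cong (to g) e))

  -- Two 3-cycles meeting in p generate the alternating group on their points.

  meet : ∀ {p q r y z} → Cycle p q r → Cycle p y z → y ≡ q ⊎ Cycle p q y
  meet {p} {q} {r} {y} {z} c d with y ≟ q | y ≟ r | z ≟ q | z ≟ r
  ... | yes y≡q | _ | _ | _ = inj₁ y≡q
  ... | no _ | yes refl | _ | _ = inj₂ c
  ... | no _ | no _ | yes refl | _ = inj₂ (reverse d)
  ... | no y≢q | no _ | no _ | yes refl = inj₂ (reverse (rotate (rotate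
    (conjugate d c (p↦q d) (fixes d (≢-sym (p≢q c)) (≢-sym y≢q) (q≢r c)) (r↦p d)))))
  -- For five different points, conjugating `c` by `d` turns (p q r) into (y q r). Its inverse `g`
  -- fixes p, and conjugating `c` by `g` replaces the points q , r by y , q.
  ... | no y≢q | no y≢r | no z≢q | no z≢r = inj₂ (reverse (conjugate g c
      (fixes g (p≢q c) (p≢q d) (≢-sym (r≢p c))) (p↦q g) (r↦p g)))
    where
    g : Cycle q y r
    g = reverse (rotate (conjugate d c (p↦q d)
      (fixes d (≢-sym (p≢q c)) (≢-sym y≢q) (≢-sym z≢q))
      (fixes d (r≢p c) (≢-sym y≢r) (≢-sym z≢r))))

  module Connected
    {λ′} (Link : X → X → Set λ′)
    (link-cycle : ∀ {p q} → Link p q → ∃[ r ] Cycle p q r)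
    (some-link  : ∀ p → ∃[ q ] Link p q)
    (connected  : ∀ (S : X → Set (x ⊔ ρ)) {p} → S p → (∀ {y z} → Link y z → S y → S z) → ∀ y → S y)
    where

    -- For fixed p and q the possible third points are closed under links: a linking cycle (y z u)
    -- that avoids p and q conjugates (p q y) to (p q z), and one that contains p or q is handled by
    -- `meet`.
    extend : ∀ {p q r} → Cycle p q r → ∀ y → y ≡ p ⊎ y ≡ q ⊎ Cycle p q y
    extend {p} {q} {r} c = connected (λ y → y ≡ p ⊎ y ≡ q ⊎ Cycle p q y) (inj₁ refl) step
      where
      atP : ∀ {y z} → Cycle p y z → y ≡ p ⊎ y ≡ q ⊎ Cycle p q y
      atP d = inj₂ (meet c d)

      atQ : ∀ {r′ y z} → Cycle p q r′ → Cycle q y z → y ≡ p ⊎ y ≡ q ⊎ Cycle p q y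
      atQ c′ d with meet (swapped c′) d
      ... | inj₁ y≡p = inj₁ y≡p
      ... | inj₂ e   = inj₂ (inj₂ (swapped e))

      step : ∀ {y z} → Link y z → y ≡ p ⊎ y ≡ q ⊎ Cycle p q y → z ≡ p ⊎ z ≡ q ⊎ Cycle p q z
      step l (inj₁ refl)        = atP (proj₂ (link-cycle l))
      step l (inj₂ (inj₁ refl)) = atQ c (proj₂ (link-cycle l))
      step {y} {z} l (inj₂ (inj₂ e)) with link-cycle l
      ... | u , d with z ≟ p | z ≟ q | u ≟ p | u ≟ q
      ...   | yes z≡p | _ | _ | _ = inj₁ z≡p
      ...   | no _ | yes z≡q | _ | _ = inj₂ (inj₁ z≡q)
      ...   | no _ | no _ | yes refl | _ = inj₂ (meet e (reverse (rotate (rotate d))))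
      ...   | no _ | no _ | no _ | yes refl = atQ e (reverse (rotate (rotate d)))
      ...   | no z≢p | no z≢q | no u≢p | no u≢q = inj₂ (inj₂ (conjugate d e
        (fixes d (≢-sym (r≢p e)) (≢-sym z≢p) (≢-sym u≢p))
        (fixes d (q≢r e) (≢-sym z≢q) (≢-sym u≢q)) (p↦q d)))

    cycle : ∀ {p q r} → p ≢ q → q ≢ r → r ≢ p → Cycle p q r
    cycle {p} {q} {r} p≢q q≢r r≢p with link-cycle (proj₂ (some-link p))
    ... | _ , c with extend c q | extend c r
    ...   | inj₁ q≡p         | _                = contradiction (sym q≡p) p≢q
    ...   | _                | inj₁ r≡p         = contradiction r≡p r≢p
    ...   | inj₂ (inj₁ refl) | inj₂ (inj₁ refl) = contradiction refl q≢r
    ...   | inj₂ (inj₁ refl) | inj₂ (inj₂ e)    = e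
    ...   | inj₂ (inj₂ d)    | inj₂ (inj₁ refl) = reverse d
    ...   | inj₂ (inj₂ d)    | inj₂ (inj₂ e) with meet (reverse d) (reverse e)
    ...     | inj₁ r≡q = contradiction (sym r≡q) q≢r
    ...     | inj₂ f   = f

    transpose : X → X → X → X
    transpose k m y with y ≟ k | y ≟ m
    ... | yes _ | _     = m
    ... | no _  | yes _ = k
    ... | no _  | no _  = y

    transpose-first : ∀ k m → transpose k m k ≡ m
    transpose-first k m with k ≟ k
    ... | yes _  = refl
    ... | no k≢k = contradiction refl k≢k

    transpose-second : ∀ k m → transpose k m m ≡ k
    transpose-second k m with m ≟ k | m ≟ m
    ... | yes m≡k | _      = m≡k
    ... | no _    | yes _  = refl
    ... | no _    | no m≢m = contradiction refl m≢m

    transpose-fixes : ∀ {k m y} → y ≢ k → y ≢ m → transpose k m y ≡ y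
    transpose-fixes {k} {m} {y} y≢k y≢m with y ≟ k | y ≟ m
    ... | yes y≡k | _       = contradiction y≡k y≢k
    ... | no _    | yes y≡m = contradiction y≡m y≢m
    ... | no _    | no _    = refl

    transpose-involutive : ∀ k m y → transpose k m (transpose k m y) ≡ y
    transpose-involutive k m y with y ≟ k | y ≟ m
    ... | yes refl | _        = transpose-second y m
    ... | no _     | yes refl = transpose-first k y
    ... | no y≢k   | no y≢m   = transpose-fixes y≢k y≢m

    transposition : X → X → X ↔ X
    transposition k m = mk↔ₛ′ (transpose k m) (transpose k m)
      (transpose-involutive k m) (transpose-involutive k m)

    module Sorting
      (id-realisable : Realisable id)
      {ν} {V : Set ν} (colour : X → V) (mate : ∀ y → ∃[ z ] z ≢ y × colour z ≡ colour y)
      where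

      open Inverse using () renaming (to to _⟶_; from to _⟵_)

      -- The third point of the cycle shares the colour of k, so that the cycle and the
      -- transposition have the same effect on colours.

      recolour : ∀ (π : X ↔ X) {k m} → k ≢ m →
        ∃[ μ ] Realisable μ × (∀ y → colour (π ⟶ μ y) ≡ colour (π ⟶ transpose k m y))
      recolour π {k} {m} k≢m with mate (π ⟶ k)
      ... | z , z≢πk , z~πk = by-cases (r ≟ m)
        where
        r = π ⟵ z

        πr : π ⟶ r ≡ z
        πr = Inverse.strictlyInverseˡ π z

        r≢k : r ≢ k
        r≢k r≡k = z≢πk (trans (sym πr) (cong (π ⟶_) r≡k))

        r~k : colour (π ⟶ r) ≡ colour (π ⟶ k)
        r~k = trans (cong colour πr) z~πk

        by-cases : Dec (r ≡ m) →
          ∃[ μ ] Realisable μ × (∀ y → colour (π ⟶ μ y) ≡ colour (π ⟶ transpose k m y))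
        -- Here k and m have the same colour themselves, so their transposition is invisible.
        by-cases (yes refl) = id , id-realisable , agree
          where
          agree : ∀ y → colour (π ⟶ y) ≡ colour (π ⟶ transpose k m y)
          agree y with y ≟ k | y ≟ m
          ... | yes refl | _        = sym r~k
          ... | no _     | yes refl = r~k
          ... | no _     | no _     = refl
        by-cases (no r≢m) = to c , realisable c , agree
          where
          c = cycle k≢m (≢-sym r≢m) r≢k
          agree : ∀ y → colour (π ⟶ to c y) ≡ colour (π ⟶ transpose k m y)
          agree y with y ≟ k | y ≟ m
          ... | yes refl | _        = cong (λ u → colour (π ⟶ u)) (p↦q c)
          ... | no _     | yes refl = trans (cong (λ u → colour (π ⟶ u)) (q↦r c)) r~k
          ... | no y≢k   | no y≢m with y ≟ r
          ...   | yes refl = trans (cong (λ u → colour (π ⟶ u)) (r↦p c)) (sym r~k)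
          ...   | no y≢r   = cong (λ u → colour (π ⟶ u)) (fixes c y≢k y≢m y≢r)

      -- The permutation `π′` is fictitious: it only has to show the same colours as `π ∘ μ`. It may
      -- therefore be multiplied by transpositions although only 3-cycles are carried out. Each
      -- transposition puts one more point in place and leaves the points already fixed alone.
      sort : ∀ ks (π : X ↔ X) → ∃[ μ ] Realisable μ × Σ[ π′ ∈ X ↔ X ]
        (∀ y → colour (π ⟶ μ y) ≡ colour (π′ ⟶ y)) × (∀ {k} → k ∈ ks → π′ ⟶ k ≡ k)
      sort []       π = id , id-realisable , π , (λ _ → refl) , λ ()
      sort (k ∷ ks) π with sort ks π
      ... | μ , μ-real , π′ , agree , fixed with (π′ ⟶ k) ≟ k
      ...   | yes k-fixed = μ , μ-real , π′ , agree , λ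
        { (here refl) → k-fixed ; (there k∈ks) → fixed k∈ks }
      ...   | no k-moved with recolour π′ {k} {π′ ⟵ k} k≢m
        where
        k≢m : k ≢ π′ ⟵ k
        k≢m e = k-moved (trans (cong (π′ ⟶_) e) (Inverse.strictlyInverseˡ π′ k))
      ...     | μ′ , μ′-real , agree′ = μ ∘ μ′ , ∘-realisable μ-real μ′-real
        , π′ ↔-∘ transposition k m , (λ y → trans (agree (μ′ y)) (agree′ y)) , λ
        { (here refl) → trans (cong (π′ ⟶_) (transpose-first k m)) πm
        ; (there {k} j∈ks) → let j-fixed = fixed j∈ks in
            trans (cong (π′ ⟶_) (transpose-fixes
              (λ { refl → k-moved j-fixed })
              (λ { refl → k-moved (trans (cong (π′ ⟶_) (trans (sym πm) j-fixed)) πm) }))) j-fixed }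
        where
        m = π′ ⟵ k
        πm : π′ ⟶ m ≡ k
        πm = Inverse.strictlyInverseˡ π′ k

-- Simultaneous 3-cycles on a family of clusters

_≟ᴬ_ : DecidableEquality Axis
x-axis ≟ᴬ x-axis = yes refl
x-axis ≟ᴬ y-axis = no λ ()
x-axis ≟ᴬ z-axis = no λ ()
y-axis ≟ᴬ x-axis = no λ ()
y-axis ≟ᴬ y-axis = yes refl
y-axis ≟ᴬ z-axis = no λ ()
z-axis ≟ᴬ x-axis = no λ ()
z-axis ≟ᴬ y-axis = no λ ()
z-axis ≟ᴬ z-axis = yes refl

_≟ᶠ_ : DecidableEquality Frame
frame i o s t ≟ᶠ frame i′ o′ s′ t′ with i ≟ᴬ i′ | o Sign.≟ o′ | s Sign.≟ s′ | t Sign.≟ t′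
... | yes refl | yes refl | yes refl | yes refl = yes refl
... | no i≢i′  | _        | _        | _        = no λ { refl → i≢i′ refl }
... | yes _    | no o≢o′  | _        | _        = no λ { refl → o≢o′ refl }
... | yes _    | yes _    | no s≢s′  | _        = no λ { refl → s≢s′ refl }
... | yes _    | yes _    | yes _    | no t≢t′  = no λ { refl → t≢t′ refl }

next≢ : ∀ i → next i ≢ i
next≢ x-axis ()
next≢ y-axis ()
next≢ z-axis ()

prev≢ : ∀ i → prev i ≢ i
prev≢ x-axis ()
prev≢ y-axis ()
prev≢ z-axis ()

flips : Frame → Frame → Set
flips m m′ = Frame.order m′ ≡ opposite (Frame.order m)

flips-≢ : ∀ {m m′} → flips m m′ → m ≢ m′
flips-≢ f refl = Sign.s≢opposite[s] _ f

flips-F : ∀ m → flips m (spinF m)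
flips-F (frame _ + _ _) = refl
flips-F (frame _ - _ _) = refl

flips-G : ∀ m → flips m (spinG m)
flips-G (frame _ + _ _) = refl
flips-G (frame _ - _ _) = refl

flips-H : ∀ m → flips m (spinH m)
flips-H _ = refl

axis-F : ∀ m → Frame.axis (spinF m) ≡ Frame.axis m
axis-F (frame _ + _ _) = refl
axis-F (frame _ - _ _) = refl

axis-G : ∀ m → Frame.axis (spinG m) ≡ prev (Frame.axis m)
axis-G (frame _ + _ _) = refl
axis-G (frame _ - _ _) = refl

data Link : Frame → Frame → Set where
  linkG : ∀ m → Link m (spinG m)
  linkH : ∀ m → Link m (spinH m)
  linkF : ∀ m → Link m (spinF m)

-- Multiplying the two equations gives s β s₀ = - s β s₀. This separates frames of different `order`
-- even when b and c agree up to sign, so that such a cluster still has 24 distinct cells.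
sign-clash : ∀ s t t′ {β s₀} → (s * t) * β ≡ t′ * s₀ → t * s₀ ≡ opposite (s * t′) * β → ⊥
sign-clash + + + refl e = Sign.s≢opposite[s] _ e
sign-clash + + - refl e = Sign.s≢opposite[s] _ e
sign-clash + - + refl e = Sign.s≢opposite[s] _ (sym e)
sign-clash + - - e′ e   = Sign.s≢opposite[s] _ (sym (trans e′ e))
sign-clash - + + refl e = Sign.s≢opposite[s] _ (sym e)
sign-clash - + - e′ e   = Sign.s≢opposite[s] _ (trans e e′)
sign-clash - - + refl e = Sign.s≢opposite[s] _ (sym e)
sign-clash - - - e′ e   = Sign.s≢opposite[s] _ (trans e′ e)

-- On a fixed face F reaches all four frames, since F once flips the order and F twice negates the
-- sign. G passes to another axis with the same side, and only H changes the side.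
connected : ∀ {σ} (S : Frame → Set σ) {p} → S p → (∀ {y z} → Link y z → S y → S z) → ∀ y → S y
connected S {frame i₀ o₀ s₀ t₀} Sp step (frame i o s t) = any-side s₀ s Sp
  where
  any-sign : ∀ {i o s} t t′ → S (frame i o s t) → S (frame i o s t′)
  any-sign + + p = p
  any-sign - - p = p
  any-sign {o = +} + - p = step (linkF _) (step (linkF _) p)
  any-sign {o = +} - + p = step (linkF _) (step (linkF _) p)
  any-sign {o = - } + - p = step (linkF _) (step (linkF _) p)
  any-sign {o = - } - + p = step (linkF _) (step (linkF _) p)

  any-order : ∀ {i s} o o′ {t t′} → S (frame i o s t) → S (frame i o′ s t′)
  any-order + + p = any-sign _ _ p
  any-order - - p = any-sign _ _ p
  any-order + - p = any-sign _ _ (step (linkF _) p)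
  any-order - + p = any-sign _ _ (step (linkF _) p)

  previous : ∀ {i o s t} → S (frame i o s t) → S (frame (prev i) + s +)
  previous p = step (linkG (frame _ - _ +)) (any-order _ - p)

  any-axis : ∀ i i′ {o o′ s t t′} → S (frame i o s t) → S (frame i′ o′ s t′)
  any-axis i i′ p with relative i i′
  ... | same   = any-order _ _ p
  ... | before = any-order _ _ (previous p)
  any-axis x-axis _ p | after = any-order _ _ (previous (previous p))
  any-axis y-axis _ p | after = any-order _ _ (previous (previous p))
  any-axis z-axis _ p | after = any-order _ _ (previous (previous p))

  any-side : ∀ s s′ {i i′ o o′ t t′} → S (frame i o s t) → S (frame i′ o′ s′ t′)
  any-side + + p = any-axis _ _ p
  any-side - - p = any-axis _ _ p
  any-side + - p = any-axis _ _ (step (linkH _) p)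
  any-side - + p = any-axis _ _ (step (linkH _) p)

module Families {ℓ} (L : Set ℓ) (_≟_ : DecidableEquality L) where
  open Cube L _≟_
  open Slabs L _≟_
  open Commutators L _≟_

  signed-injective : ∀ {s s′ a a′} → signed s a ≡ signed s′ a′ → s ≡ s′ × a ≡ a′
  signed-injective refl = refl , refl

  fin-injective : ∀ {v w} → fin v ≡ fin w → v ≡ w
  fin-injective refl = refl

  faceCell-at : ∀ c i {s} → c ! i ≡ ∞ s → ∃[ v ] ∃[ w ] c ≡ faceCell i s v w
  faceCell-at (cell _ (only-x s b c)) x-axis refl = _ , _ , refl
  faceCell-at (cell _ (only-y a s c)) y-axis refl = _ , _ , refl
  faceCell-at (cell _ (only-z a b s)) z-axis refl = _ , _ , refl

  -- Low is the predicate of the coordinates on which no slice may be turned.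

  module Family {λ′} (Low : L† → Set λ′) (b : L†) (b-high : ∀ u → ¬ Low (u · b)) (s₀ : Sign) where

    place : L → Frame → Cell
    place a = embed b (signed s₀ a)

    place-injective : ∀ {a a′} m m′ → place a m ≡ place a′ m′ → a ≡ a′ × m ≡ m′
    place-injective (frame i + s t) (frame i′ + s′ t′) e with faceCell-injective i i′ e
    ... | refl , refl , _ , ew with signed-injective ew
    ...   | et , refl with Sign.*-cancelʳ-≡ s₀ t t′ et
    ...     | refl = refl , refl
    place-injective (frame i - s t) (frame i′ - s′ t′) e with faceCell-injective i i′ e
    ... | refl , refl , ev , _ with signed-injective ev
    ...   | et , refl with Sign.*-cancelʳ-≡ s₀ t t′ et
    ...     | refl = refl , refl
    place-injective (frame i + s t) (frame i′ - s′ t′) e with faceCell-injective i i′ e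
    ... | refl , refl , ev , ew = contradiction (ev , ew) (clash b)
      where
      clash : ∀ b {a a′} → ¬ ((s * t) · b ≡ t′ · signed s₀ a′ × t · signed s₀ a ≡ opposite (s * t′) · b)
      clash (signed β d) (ev , ew) =
        sign-clash s t t′ (proj₁ (signed-injective ev)) (proj₁ (signed-injective ew))
    place-injective (frame i - s t) (frame i′ + s′ t′) e with faceCell-injective i i′ e
    ... | refl , refl , ev , ew = contradiction (sym ev , sym ew) (clash b)
      where
      clash : ∀ b {a a′} → ¬ ((s * t′) · b ≡ t · signed s₀ a′ × t′ · signed s₀ a ≡ opposite (s * t) · b)
      clash (signed β d) (ev , ew) =
        sign-clash s t′ t (proj₁ (signed-injective ev)) (proj₁ (signed-injective ew))

    Quiet : (L̄† → Bool) → Set _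
    Quiet E = ∀ v → Low v → E (fin v) ≡ false

    Polite : Letter → Set _
    Polite (d , i , E) = Quiet E

    Good : (L → Bool) → Set _
    Good D = ∀ a → D a ≡ true → ∀ s → ¬ Low (signed s a)

    Member : (L → Bool) → Cell → Set _
    Member D c = ∃[ a ] D a ≡ true × ∃[ m ] c ≡ place a m

    Realises : (L → Bool) → (Frame → Frame) → Word → Set _
    Realises D μ w = All Polite w
      × (∀ a → D a ≡ true → ∀ m → pull w (place a m) ≡ place a (μ m))
      × (∀ c → ¬ Member D c → pull w c ≡ c)

    -- Uniform in `D`, because the members of a family are scrambled differently: the family is
    -- split by colour pattern, and each part needs its own permutation while the other parts stay
    -- fixed.
    Realisable : (Frame → Frame) → Set _
    Realisable μ = ∀ D → Good D → ∃[ w ] Realises D μ w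

    id-realisable : Realisable id
    id-realisable D _ = [] , [] , (λ _ _ _ → refl) , λ _ _ → refl

    ∘-realisable : ∀ {μ ν} → Realisable μ → Realisable ν → Realisable (μ ∘ ν)
    ∘-realisable {μ} {ν} rμ rν D good with rμ D good | rν D good
    ... | v , v-polite , v-acts , v-fixes | w , w-polite , w-acts , w-fixes = v ++ w
      , All.++⁺ v-polite w-polite
      , (λ a Da m → trans (pull-++ v w _) (trans (cong (pull v) (w-acts a Da m)) (v-acts a Da (ν m))))
      , λ c ∉D → trans (pull-++ v w c) (trans (cong (pull v) (w-fixes c ∉D)) (v-fixes c ∉D))

    open Cycles _≟ᶠ_ Realisable (λ {μ} {ν} → ∘-realisable {μ} {ν}) public

    module _ (D : L → Bool) (good : Good D) where

      family : Sign → L̄† → Bool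
      family t (fin (signed s a)) = does (s Sign.≟ t * s₀) ∧ D a
      family t (fin 0†)           = false
      family t (∞ _)              = false

      family-sound : ∀ t v → family t (fin v) ≡ true → ∃[ a ] D a ≡ true × v ≡ t · signed s₀ a
      family-sound t (signed s a) e with s Sign.≟ t * s₀
      ... | yes refl = a , e , refl

      family-complete : ∀ t a → D a ≡ true → family t (fin (t · signed s₀ a)) ≡ true
      family-complete t a Da rewrite dec-true (t * s₀ Sign.≟ t * s₀) refl = Da

      family-quiet : ∀ t → Quiet (family t)
      family-quiet t 0†           low = refl
      family-quiet t (signed s a) low with s Sign.≟ t * s₀ | D a in eq
      ... | no _  | _     = refl
      ... | yes _ | false = refl
      ... | yes _ | true  = contradiction low (good a eq s)

      slice-quiet : ∀ u → Quiet (is (fin (u · b)))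
      slice-quiet u v low = is-≢ λ e → b-high u (subst Low (fin-injective e) low)

      -- The axis carrying b gets a single slice and the axis carrying c gets the whole slab. On the
      -- face of m these cross exactly in the cells of frame m, one for each member of `D`.
      nextSlab prevSlab : Frame → L̄† → Bool
      nextSlab (frame i + s t) = is (fin ((s * t) · b))
      nextSlab (frame i - s t) = family t
      prevSlab (frame i + s t) = family t
      prevSlab (frame i - s t) = is (fin (opposite (s * t) · b))

      nextSlab-quiet : ∀ m → Quiet (nextSlab m)
      nextSlab-quiet (frame i + s t) = slice-quiet (s * t)
      nextSlab-quiet (frame i - s t) = family-quiet t

      prevSlab-quiet : ∀ m → Quiet (prevSlab m)
      prevSlab-quiet (frame i + s t) = family-quiet t
      prevSlab-quiet (frame i - s t) = slice-quiet (opposite (s * t))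

      nextSlab-finitary : ∀ m → Finitary (nextSlab m)
      nextSlab-finitary (frame i + s t) _ = refl
      nextSlab-finitary (frame i - s t) _ = refl

      prevSlab-finitary : ∀ m → Finitary (prevSlab m)
      prevSlab-finitary (frame i + s t) _ = refl
      prevSlab-finitary (frame i - s t) _ = refl

      Meeting : Frame → Cell → Set _
      Meeting m c = c ! Frame.axis m ≡ ∞ (Frame.side m)
        × nextSlab m (c ! next (Frame.axis m)) ≡ true × prevSlab m (c ! prev (Frame.axis m)) ≡ true

      meeting-sound : ∀ m c → Meeting m c → ∃[ a ] D a ≡ true × c ≡ place a m
      meeting-sound (frame i o s t) c (p , e , e′) with faceCell-at c i p
      meeting-sound (frame i + s t) _ (p , e , e′) | v , w , refl
        rewrite face-next i {s} {v} {w} | face-prev i {s} {v} {w}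
        with is-sound (fin ((s * t) · b)) (fin v) e | family-sound t w e′
      ... | refl | a , Da , refl = a , Da , refl
      meeting-sound (frame i - s t) _ (p , e , e′) | v , w , refl
        rewrite face-next i {s} {v} {w} | face-prev i {s} {v} {w}
        with is-sound (fin (opposite (s * t) · b)) (fin w) e′ | family-sound t v e
      ... | refl | a , Da , refl = a , Da , refl

      meeting-complete : ∀ m a → D a ≡ true → Meeting m (place a m)
      meeting-complete (frame i + s t) a Da = face-axis i
        , trans (cong (is _) (face-next i)) (is-refl (fin ((s * t) · b)))
        , trans (cong (family t) (face-prev i)) (family-complete t a Da)
      meeting-complete (frame i - s t) a Da = face-axis i
        , trans (cong (family t) (face-next i)) (family-complete t a Da)
        , trans (cong (is _) (face-prev i)) (is-refl (fin (opposite (s * t) · b)))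

      module Base (m g : Frame) (m≢g : m ≢ g) (g≢F : g ≢ spinF m)
        {j k} (dist : Distinct (Frame.axis m) j k) E E′ (E-quiet : Quiet E) (E′-quiet : Quiet E′)
        (E-finitary : Finitary E) (E′-finitary : Finitary E′)
        (to-meeting   : ∀ c → c ! Frame.axis m ≡ ∞ (Frame.side m) ×
                              E (c ! j) ≡ true × E′ (c ! k) ≡ true → Meeting m c)
        (from-meeting : ∀ c → Meeting m c → c ! Frame.axis m ≡ ∞ (Frame.side m) ×
                              E (c ! j) ≡ true × E′ (c ! k) ≡ true)
        (turns : ∀ a → spin + j (place a m) ≡ place a g)
        where

        open ThreeCycle dist (Frame.side m) E E′ E-finitary E′-finitary

        private
          F≢m : spinF m ≢ m
          F≢m = ≢-sym (flips-≢ {m} {spinF m} (flips-F m))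

          turnsF : ∀ a → spin + (Frame.axis m) (place a m) ≡ place a (spinF m)
          turnsF a = spin-embed-F b (signed s₀ a) m

          pivot-place : ∀ a → D a ≡ true → Pivot (place a m)
          pivot-place a Da = from-meeting (place a m) (meeting-complete m a Da)

          place-pivot : ∀ c → Pivot c → ∃[ a ] D a ≡ true × c ≡ place a m
          place-pivot c q = meeting-sound m c (to-meeting c q)

          off : ∀ c → Pivot c → ¬ Pivot (spin + (Frame.axis m) c)
          off c q q′ with place-pivot c q
          ... | a , Da , refl with place-pivot _ q′
          ...   | a′ , _ , e = F≢m (proj₂ (place-injective (spinF m) m (trans (sym (turnsF a)) e)))

          pivot? : ∀ c → Dec (Pivot c)
          pivot? c with (c ! Frame.axis m) ≟̄ ∞ (Frame.side m) | E (c ! j) in e | E′ (c ! k) in e′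
          ... | yes p | true  | true  = yes (p , refl , refl)
          ... | no ¬p | _     | _     = no (¬p ∘ proj₁)
          ... | yes _ | false | _     = no λ ()
          ... | yes _ | true  | false = no λ ()

        realises : Realises D (cyc m g (spinF m)) threeCycle
        realises = politeness , acts , fixed
          where
          F-quiet : Quiet (is (∞ (Frame.side m)))
          F-quiet v _ = refl

          politeness : All Polite threeCycle
          politeness = E-quiet ∷ E′-quiet ∷ E-quiet ∷ E′-quiet ∷ F-quiet
                     ∷ E′-quiet ∷ E-quiet ∷ E′-quiet ∷ E-quiet ∷ F-quiet ∷ []

          acts : ∀ a → D a ≡ true → ∀ y → pull threeCycle (place a y) ≡ place a (cyc m g (spinF m) y)
          acts a Da y with y ≟ᶠ m | y ≟ᶠ g | y ≟ᶠ spinF m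
          ... | yes refl | _ | _ = trans (threeCycle-pivot off _ (pivot-place a Da)) (turns a)
          ... | no _ | yes refl | _ = trans (cong (pull threeCycle) (sym (turns a)))
            (trans (threeCycle-spinʲ off _ (pivot-place a Da)) (turnsF a))
          ... | no _ | no _ | yes refl = trans (cong (pull threeCycle) (sym (turnsF a)))
            (threeCycle-spinⁱ off _ (pivot-place a Da))
          ... | no y≢m | no y≢g | no y≢F = threeCycle-fix off pivot? _
            (λ q → let _ , _ , e = place-pivot _ q in y≢m (proj₂ (place-injective y m e)))
            (λ c q e → let a′ , _ , e′ = place-pivot c q in y≢g (proj₂ (place-injective y g
              (trans e (trans (cong (spin + j) e′) (turns a′))))))
            (λ c q e → let a′ , _ , e′ = place-pivot c q in y≢F (proj₂ (place-injective y (spinF m)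
              (trans e (trans (cong (spin + (Frame.axis m)) e′) (turnsF a′))))))

          fixed : ∀ c → ¬ Member D c → pull threeCycle c ≡ c
          fixed c ∉D = threeCycle-fix off pivot? c
            (λ q → let a , Da , e = place-pivot c q in ∉D (a , Da , m , e))
            (λ c′ q e → let a , Da , e′ = place-pivot c′ q in ∉D (a , Da , g ,
              trans e (trans (cong (spin + j) e′) (turns a))))
            (λ c′ q e → let a , Da , e′ = place-pivot c′ q in ∉D (a , Da , spinF m ,
              trans e (trans (cong (spin + (Frame.axis m)) e′) (turnsF a))))

    G≢F : ∀ m → spinG m ≢ spinF m
    G≢F m e = prev≢ _ (trans (sym (axis-G m)) (trans (cong Frame.axis e) (axis-F m)))

    H≢F : ∀ m → spinH m ≢ spinF m
    H≢F m e = next≢ _ (trans (cong Frame.axis e) (axis-F m))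

    cycleG : ∀ m → Cycle m (spinG m) (spinF m)
    cycleG m = cyc-cycle (flips-≢ (flips-G m)) (G≢F m) (≢-sym (flips-≢ (flips-F m))) λ D good →
      _ , Base.realises D good m (spinG m) (flips-≢ (flips-G m)) (G≢F m) cyclic (nextSlab D good m) (prevSlab D good m)
        (nextSlab-quiet D good m) (prevSlab-quiet D good m)
        (nextSlab-finitary D good m) (prevSlab-finitary D good m)
        (λ c q → q) (λ c q → q) (λ a → spin-embed-G b (signed s₀ a) m)

    -- Exchanging the two slabs replaces the inner commutator by its inverse, so the pivot leaves
    -- its face about the other axis. This is the cycle that reaches frames on the opposite side.
    cycleH : ∀ m → Cycle m (spinH m) (spinF m)
    cycleH m = cyc-cycle (flips-≢ (flips-H m)) (H≢F m) (≢-sym (flips-≢ (flips-F m))) λ D good →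
      _ , Base.realises D good m (spinH m) (flips-≢ (flips-H m)) (H≢F m) anticyclic (prevSlab D good m) (nextSlab D good m)
        (prevSlab-quiet D good m) (nextSlab-quiet D good m)
        (prevSlab-finitary D good m) (nextSlab-finitary D good m)
        (λ c (p , e , e′) → p , e′ , e) (λ c (p , e , e′) → p , e′ , e)
        (λ a → spin-embed-H b (signed s₀ a) m)

    link-cycle : ∀ {p q} → Link p q → ∃[ r ] Cycle p q r
    link-cycle (linkG m) = spinF m , cycleG m
    link-cycle (linkH m) = spinF m , cycleH m
    link-cycle (linkF m) = spinG m , reverse (cycleG m)

    open Connected Link link-cycle (λ p → spinF p , linkF p) connected public

-- Solving a family of clusters

axes : List Axis
axes = x-axis ∷ y-axis ∷ z-axis ∷ []

∈-axes : ∀ i → i ∈ axes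
∈-axes x-axis = here refl
∈-axes y-axis = there (here refl)
∈-axes z-axis = there (there (here refl))

signs : List Sign
signs = + ∷ - ∷ []

∈-signs : ∀ s → s ∈ signs
∈-signs + = here refl
∈-signs - = there (here refl)

abstract
  frames : List Frame
  frames = cartesianProductWith _$_
    (cartesianProductWith _$_ (cartesianProductWith frame axes signs) signs) signs

  ∈-frames : ∀ m → m ∈ frames
  ∈-frames (frame i o s t) = ∈-cartesianProductWith⁺ _$_
    (∈-cartesianProductWith⁺ _$_ (∈-cartesianProductWith⁺ frame (∈-axes i) (∈-signs o)) (∈-signs s))
    (∈-signs t)

values : List Value
values = NaC ∷ map colour (red ∷ white ∷ green ∷ orange ∷ yellow ∷ blue ∷ [])

∈-values : ∀ v → v ∈ values
∈-values NaC             = here refl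
∈-values (colour red)    = there (here refl)
∈-values (colour white)  = there (there (here refl))
∈-values (colour green)  = there (there (there (here refl)))
∈-values (colour orange) = there (there (there (there (here refl))))
∈-values (colour yellow) = there (there (there (there (there (here refl)))))
∈-values (colour blue)   = there (there (there (there (there (there (here refl))))))

∧-trueˡ : ∀ {x y} → x ∧ y ≡ true → x ≡ true
∧-trueˡ {true} _ = refl

∧-clash : ∀ x {y} → x ∧ y ≡ true → x ∧ not y ≢ true
∧-clash true {true}  _  ()
∧-clash true {false} () _

module Representatives (em : ∀ {a} → ExcludedMiddle a) {x v} {X : Set x} {V : Set v}
  (vs : List V) (∈-vs : ∀ v → v ∈ vs) where

  Represents : ∀ {p} {P : (X → V) → Set p} → List X → (X → V) → ∃ P → Set _
  Represents ks h r = ∀ k → k ∈ ks → proj₁ r k ≡ h k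

  -- As V is finite, the functions fall into finitely many classes by their values on `ks`. One
  -- member of every inhabited class is kept together with its proof of P, by induction on `ks`,
  -- splitting by the value at the head. Thus finitely many solutions will serve infinitely many
  -- clusters.
  representatives : ∀ {p} (P : (X → V) → Set p) (ks : List X) →
    Σ[ rs ∈ List (∃ P) ] (∀ h → P h → Any (Represents ks h) rs)
  representatives P [] with em {P = ∃ P}
  ... | yes r = r ∷ [] , λ h _ → here λ _ ()
  ... | no ¬P = []     , λ h Ph → contradiction (h , Ph) ¬P
  representatives P (k ∷ ks) with go vs
    where
    go : ∀ ws → Σ[ rs ∈ List (∃ P) ] (∀ h → P h → h k ∈ ws → Any (Represents (k ∷ ks) h) rs)
    go []       = [] , λ h _ ()
    go (w ∷ ws) with representatives (λ h → h k ≡ w × P h) ks | go ws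
    ... | rs , rs-rep | rs′ , rs′-rep = map (map₂ proj₂) rs ++ rs′ , λ
      { h Ph (here hk≡w)  → Any.++⁺ˡ (Any.map⁺ (Any.map
          (λ { {_ , rk≡w , _} agree _ (here refl) → trans rk≡w (sym hk≡w)
             ; agree j (there j∈ks) → agree j j∈ks }) (rs-rep h (hk≡w , Ph))))
      ; h Ph (there hk∈ws) → Any.++⁺ʳ (map (map₂ proj₂) rs) (rs′-rep h Ph hk∈ws) }
  ... | rs , rep = rs , λ h Ph → rep h Ph (∈-vs (h k))

module FamilySolving (em : ∀ {a} → ExcludedMiddle a) {ℓ} (L : Set ℓ) (_≟_ : DecidableEquality L) where
  open Cube L _≟_
  open Slabs L _≟_
  open Families L _≟_
  open Representatives em {X = Frame} values ∈-values

  hue : Frame → Value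
  hue (frame i o s t) = solved (faceCell i s 0† 0†)

  solved-embed : ∀ b c m → solved (embed b c m) ≡ hue m
  solved-embed b c (frame i + s t) = solved-face i
  solved-embed b c (frame i - s t) = solved-face i

  hue-F : ∀ m → hue (spinF m) ≡ hue m
  hue-F (frame i + s t) = refl
  hue-F (frame i - s t) = refl

  module _ {λ′} (Low : L† → Set λ′) (b : L†) (b-high : ∀ u → ¬ Low (u · b)) (s₀ : Sign) where
    open Family Low b b-high s₀
    -- The mate of a position is its image under the quarter turn of its own face.
    open Sorting (λ D → id-realisable D) hue (λ m → spinF m , ≢-sym (flips-≢ (flips-F m)) , hue-F m)

    permute : L → Word → Frame ↔ Frame
    permute a w = mk↔ₛ′ (ahead w) (ahead (inverse w))
      (λ m → proj₂ (place-injective _ m (trans (sym (ahead-place w _))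
        (trans (cong (pull w) (sym (ahead-place (inverse w) m))) (pull-inverseʳ w _)))))
      (λ m → proj₂ (place-injective _ m (trans (sym (ahead-place (inverse w) _))
        (trans (cong (pull (inverse w)) (sym (ahead-place w m))) (pull-inverseˡ w _)))))
      where
      ahead : Word → Frame → Frame
      ahead w m = proj₁ (pull-embed b (signed s₀ a) w m)
      ahead-place : ∀ w m → pull w (place a m) ≡ place a (ahead w m)
      ahead-place w m = proj₂ (pull-embed b (signed s₀ a) w m)

    permute-place : ∀ a w m → pull w (place a m) ≡ place a (Inverse.to (permute a w) m)
    permute-place a w m = proj₂ (pull-embed b (signed s₀ a) w m)

    Solvable : (Frame → Value) → Set _
    Solvable h = ∃[ μ ] Realisable μ × (∀ m → h (μ m) ≡ hue m)

    Scrambled : (Cell → Value) → L → Set _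
    Scrambled g a = ∃[ w ] ∀ m → g (place a m) ≡ solved (pull w (place a m))

    scrambled-solvable : ∀ g a → Scrambled g a → Solvable (g ∘ place a)
    scrambled-solvable g a (w , scrambled) with sort frames (permute a w)
    ... | μ , μ-real , π′ , agree , fixed = μ , μ-real , λ m → begin
      g (place a (μ m))                              ≡⟨ scrambled (μ m) ⟩
      solved (pull w (place a (μ m)))                ≡⟨ cong solved (permute-place a w (μ m)) ⟩
      solved (place a (Inverse.to (permute a w) (μ m))) ≡⟨ solved-embed b (signed s₀ a) (Inverse.to (permute a w) (μ m)) ⟩
      hue (Inverse.to (permute a w) (μ m))           ≡⟨ agree m ⟩
      hue (Inverse.to π′ m)                          ≡⟨ cong hue (fixed (∈-frames m)) ⟩
      hue m                                          ∎
      where open ≡-Reasoning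

    Solves : (L → Bool) → (Cell → Value) → Word → Set _
    Solves D g w = All Polite w
      × (∀ a → D a ≡ true → ∀ m → g (pull w (place a m)) ≡ hue m)
      × (∀ c → ¬ Member D c → pull w c ≡ c)

    -- Every pattern in the list contributes one word, aimed at the members of `D` that show this
    -- pattern. A word fixes all cells outside its own part, so the words do not interfere and each
    -- may be chosen for the original g.
    merge : ∀ (hs : List (∃ Solvable)) D → Good D → ∀ g →
      (∀ a → D a ≡ true → Any (Represents frames (g ∘ place a)) hs) → ∃ (Solves D g)
    merge [] D good g rep = [] , [] , (λ a Da → contradiction (rep a Da) λ ()) , λ _ _ → refl
    merge ((h , μ , μ-real , h-solved) ∷ hs) D good g rep = combine
      (μ-real D₁ λ a e → good a (sub₁ a e))
      (merge hs D₂ (λ a e → good a (sub₂ a e)) g rep₂)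
      where
      like? : ∀ a → Dec (∀ m → m ∈ frames → h m ≡ g (place a m))
      like? a = em
      D₁ D₂ : L → Bool
      D₁ a = D a ∧ does (like? a)
      D₂ a = D a ∧ not (does (like? a))
      sub₁ : ∀ a → D₁ a ≡ true → D a ≡ true
      sub₁ a = ∧-trueˡ
      sub₂ : ∀ a → D₂ a ≡ true → D a ≡ true
      sub₂ a = ∧-trueˡ
      disjoint : ∀ a → D₁ a ≡ true → D₂ a ≢ true
      disjoint a = ∧-clash (D a)
      split : ∀ a → D a ≡ true → (D₁ a ≡ true × (∀ m → h m ≡ g (place a m))) ⊎ D₂ a ≡ true
      split a Da rewrite Da with like? a
      ... | yes r = inj₁ (refl , λ m → r m (∈-frames m))
      ... | no _  = inj₂ refl
      rep₂ : ∀ a → D₂ a ≡ true → Any (Represents frames (g ∘ place a)) hs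
      rep₂ a e with rep a (sub₂ a e)
      ... | there r = r
      ... | here r  = contradiction e (disjoint a (cong₂ _∧_ (sub₂ a e) (dec-true (like? a) r)))
      outside₁ : ∀ a → D₂ a ≡ true → ∀ m → ¬ Member D₁ (place a m)
      outside₁ a e m (a′ , e′ , m′ , eq) with place-injective m m′ eq
      ... | refl , _ = disjoint a e′ e
      outside₂ : ∀ a → D₁ a ≡ true → ∀ m → ¬ Member D₂ (place a m)
      outside₂ a e m (a′ , e′ , m′ , eq) with place-injective m m′ eq
      ... | refl , _ = disjoint a e e′
      combine : ∃ (Realises D₁ μ) → ∃ (Solves D₂ g) → ∃ (Solves D g)
      combine (v₁ , polite₁ , acts₁ , fixes₁) (v₂ , polite₂ , acts₂ , fixes₂) =
        v₂ ++ v₁ , All.++⁺ polite₂ polite₁ , acts , fixes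
        where
        acts : ∀ a → D a ≡ true → ∀ m → g (pull (v₂ ++ v₁) (place a m)) ≡ hue m
        acts a Da m with split a Da
        ... | inj₁ (e , like) = begin
          g (pull (v₂ ++ v₁) (place a m))     ≡⟨ cong g (pull-++ v₂ v₁ _) ⟩
          g (pull v₂ (pull v₁ (place a m)))   ≡⟨ cong (g ∘ pull v₂) (acts₁ a e m) ⟩
          g (pull v₂ (place a (μ m)))         ≡⟨ cong g (fixes₂ _ (outside₂ a e (μ m))) ⟩
          g (place a (μ m))                   ≡⟨ like (μ m) ⟨
          h (μ m)                             ≡⟨ h-solved m ⟩
          hue m                               ∎
          where open ≡-Reasoning
        ... | inj₂ e = trans (cong g (trans (pull-++ v₂ v₁ _)
                (cong (pull v₂) (fixes₁ _ (outside₁ a e m))))) (acts₂ a e m)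
        fixes : ∀ c → ¬ Member D c → pull (v₂ ++ v₁) c ≡ c
        fixes c ∉D = trans (pull-++ v₂ v₁ c) (trans
          (cong (pull v₂) (fixes₁ c (λ (a , e , r) → ∉D (a , sub₁ a e , r))))
          (fixes₂ c (λ (a , e , r) → ∉D (a , sub₂ a e , r))))

    solve-family : ∀ D → Good D → ∀ g → (∀ a → D a ≡ true → Scrambled g a) → ∃ (Solves D g)
    solve-family D good g scrambled with representatives Solvable frames
    ... | hs , rep = merge hs D good g
      λ a Da → rep (g ∘ place a) (scrambled-solvable g a (scrambled a Da))

-- Stages of the solution

module Solving (em : ∀ {a} → ExcludedMiddle a) {ℓ} (L : Set ℓ)
  (_≟_ : DecidableEquality L) (L⤖ℕ : L ⤖ ℕ) where
  open Cube L _≟_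
  open Slabs L _≟_
  open Families L _≟_
  open FamilySolving em L _≟_

  index : L → ℕ
  index = Bijection.to L⤖ℕ

  element : ℕ → L
  element = Inverse.from (⤖⇒↔ L⤖ℕ)

  index-element : ∀ n → index (element n) ≡ n
  index-element = Inverse.strictlyInverseˡ (⤖⇒↔ L⤖ℕ)

  element-index : ∀ a → element (index a) ≡ a
  element-index = Inverse.strictlyInverseʳ (⤖⇒↔ L⤖ℕ)

  rank : L† → ℕ
  rank 0†           = 0
  rank (signed s a) = suc (index a)

  pivot : ℕ → L†
  pivot zero    = 0†
  pivot (suc n) = signed + (element n)

  rank-· : ∀ u v → rank (u · v) ≡ rank v
  rank-· u (signed s a) = refl
  rank-· u 0†           = refl

  rank-neg : ∀ v → rank (neg† v) ≡ rank v
  rank-neg (signed s a) = refl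
  rank-neg 0†           = refl

  rank-pivot : ∀ n → rank (pivot n) ≡ n
  rank-pivot zero    = refl
  rank-pivot (suc n) = cong suc (index-element n)

  unrank : ∀ v → ∃[ u ] v ≡ u · pivot (rank v)
  unrank 0†           = + , refl
  unrank (signed s a) = s , cong₂ signed (sym (Sign.*-identityʳ s)) (sym (element-index a))

  Low : ℕ → L† → Set
  Low n v = rank v ℕ.< n

  pivot-high : ∀ n u → ¬ Low n (u · pivot n)
  pivot-high n u low = ℕ.<-irrefl (trans (rank-· u (pivot n)) (rank-pivot n)) low

  module Phase (n : ℕ) (s₀ : Sign) = Family (Low n) (pivot n) (pivot-high n) s₀

  -- Nothing is demanded at ±∞: every 3-cycle contains face turns, so faces go on turning at all
  -- levels.
  Polite : ℕ → Letter → Set ℓ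
  Polite n (d , i , E) = ∀ v → Low n v → E (fin v) ≡ false

  -- The word depends on the cluster; an infinite sequence need not amount to one finite word on all
  -- clusters at once.
  Local : Configuration → Set ℓ
  Local g = ∀ b c → ∃[ w ] ∀ m → g (embed b c m) ≡ solved (pull w (embed b c m))

  local-pull : ∀ g w → Local g → Local (g ∘ pull w)
  local-pull g w loc b c with loc b c
  ... | v , scrambled = v ++ w , λ m → begin
    g (pull w (embed b c m))               ≡⟨ cong g (ahead m) ⟩
    g (embed b c (m′ m))                   ≡⟨ scrambled (m′ m) ⟩
    solved (pull v (embed b c (m′ m)))     ≡⟨ cong (solved ∘ pull v) (ahead m) ⟨
    solved (pull v (pull w (embed b c m))) ≡⟨ cong solved (pull-++ v w _) ⟨
    solved (pull (v ++ w) (embed b c m))   ∎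
    where
    open ≡-Reasoning
    m′ = λ m → proj₁ (pull-embed b c w m)
    ahead = λ m → proj₂ (pull-embed b c w m)

  data Early (n : ℕ) (v w : L†) : Set ℓ where
    lowˡ    : Low n v → Early n v w
    lowʳ    : Low n w → Early n v w
    central : v ≡ 0† → w ≡ 0† → Early n v w

  Settled : ℕ → Configuration → Set ℓ
  Settled n g = ∀ i s v w → Early n v w → g (faceCell i s v w) ≡ solved (faceCell i s v w)

  upper : ℕ → L → Bool
  upper n a = does (n ℕ.≤? suc (index a))

  upper-complete : ∀ n a → n ℕ.≤ suc (index a) → upper n a ≡ true
  upper-complete n a = dec-true (n ℕ.≤? suc (index a))

  upper-good : ∀ n s₀ → Phase.Good n s₀ (upper n)
  upper-good n s₀ a e s = ℕ.≤⇒≯ (does-sound (n ℕ.≤? suc (index a)) e)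

  Treated : ℕ → Sign → Cell → Set ℓ
  Treated n s₀ = Phase.Member n s₀ (upper n)

  Treats : ℕ → Sign → Configuration → Word → Set ℓ
  Treats n s₀ g w = All (Polite n) w
    × (∀ c → Treated n s₀ c → g (pull w c) ≡ solved c) × (∀ c → ¬ Treated n s₀ c → pull w c ≡ c)

  phase : ∀ n s₀ g → Local g → ∃ (Treats n s₀ g)
  phase n s₀ g loc
    with solve-family (Low n) (pivot n) (pivot-high n) s₀ (upper n) (upper-good n s₀) g
           (λ a _ → loc (pivot n) (signed s₀ a))
  ... | w , polite , acts , fixes = w , polite
    , (λ { _ (a , Da , m , refl) → trans (acts a Da m) (sym (solved-embed (pivot n) (signed s₀ a) m)) })
    , fixes

  Covered : ℕ → Cell → Set ℓ
  Covered n c = ∃[ s₀ ] Treated n s₀ c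

  cancel : ∀ s u → s * (s * u) ≡ u
  cancel + u = refl
  cancel - u = Sign.opposite-involutive u

  coverˡ : ∀ n i s v a → rank v ≡ n → n ℕ.≤ suc (index a) → ∀ s′ →
    Covered n (faceCell i s v (signed s′ a))
  coverˡ _ i s v a refl n≤ s′ with unrank v
  -- With u the sign of v relative to the pivot, t solves s * t ≡ u, and then s₀ solves t * s₀ ≡ s′.
  ... | u , e = t * s′ , a , upper-complete _ a n≤ , frame i + s t , cong₂ (faceCell i s)
    (trans e (cong (_· pivot (rank v)) (sym (cancel s u))))
    (cong (λ s″ → signed s″ a) (sym (cancel t s′)))
    where t = s * u

  coverʳ : ∀ n i s w a → rank w ≡ n → n ℕ.≤ suc (index a) → ∀ s′ →
    Covered n (faceCell i s (signed s′ a) w)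
  coverʳ _ i s w a refl n≤ s′ with unrank w
  ... | u , e = t * s′ , a , upper-complete _ a n≤ , frame i - s t , cong₂ (faceCell i s)
    (cong (λ s″ → signed s″ a) (sym (cancel t s′)))
    (trans e (cong (_· pivot (rank w)) (sym (trans (cong opposite (cancel s (opposite u)))
      (Sign.opposite-involutive u)))))
    where t = s * opposite u

  rank-zero : ∀ v → rank v ≡ 0 → v ≡ 0†
  rank-zero 0† _ = refl

  cover : ∀ n i s v w → Early (suc n) v w → Early n v w ⊎ Covered n (faceCell i s v w)
  cover n i s v w (central v≡0 w≡0) = inj₁ (central v≡0 w≡0)
  cover n i s v w (lowˡ v<) with ℕ.m<1+n⇒m<n∨m≡n v< | rank w ℕ.<? n
  ... | inj₁ v<n | _      = inj₁ (lowˡ v<n)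
  ... | inj₂ _   | yes w< = inj₁ (lowʳ w<)
  ... | inj₂ v≡n | no w≮  = by-cases w w≮
    where
    by-cases : ∀ w → ¬ Low n w → Early n v w ⊎ Covered n (faceCell i s v w)
    -- A zero coordinate that is not low forces n to be 0, so the cell is a centre, and centres are
    -- settled beforehand.
    by-cases 0†            w≮ = inj₁ (central (rank-zero v (trans v≡n (ℕ.n≤0⇒n≡0 (ℕ.≮⇒≥ w≮)))) refl)
    by-cases (signed s′ a) w≮ = inj₂ (coverˡ n i s v a v≡n (ℕ.≮⇒≥ w≮) s′)
  cover n i s v w (lowʳ w<) with ℕ.m<1+n⇒m<n∨m≡n w< | rank v ℕ.<? n
  ... | inj₁ w<n | _      = inj₁ (lowʳ w<n)
  ... | inj₂ _   | yes v< = inj₁ (lowˡ v<)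
  ... | inj₂ w≡n | no v≮  = by-cases v v≮
    where
    by-cases : ∀ v → ¬ Low n v → Early n v w ⊎ Covered n (faceCell i s v w)
    by-cases 0†            v≮ = inj₁ (central refl (rank-zero w (trans w≡n (ℕ.n≤0⇒n≡0 (ℕ.≮⇒≥ v≮)))))
    by-cases (signed s′ a) v≮ = inj₂ (coverʳ n i s w a w≡n (ℕ.≮⇒≥ v≮) s′)

  abstract
    stage : ∀ n g → Local g → Settled n g → ∃[ w ] All (Polite n) w × Settled (suc n) (g ∘ pull w)
    stage n g loc settled =
      let w₁ , treats₁ = phase n + g loc in
      combine w₁ treats₁ (phase n - (g ∘ pull w₁) (local-pull g w₁ loc))
      where
      combine : ∀ w₁ → Treats n + g w₁ → ∃ (Treats n - (g ∘ pull w₁)) →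
        ∃[ w ] All (Polite n) w × Settled (suc n) (g ∘ pull w)
      combine w₁ (polite₁ , acts₁ , fixes₁) (w₂ , polite₂ , acts₂ , fixes₂) =
        w₁ ++ w₂ , All.++⁺ polite₁ polite₂ , settled′
        where
        unfold : ∀ c → g (pull (w₁ ++ w₂) c) ≡ g (pull w₁ (pull w₂ c))
        unfold c = cong g (pull-++ w₁ w₂ c)

        solves : ∀ c → Treated n + c ⊎ g c ≡ solved c → g (pull (w₁ ++ w₂) c) ≡ solved c
        solves c hyp = trans (unfold c) (by-cases em em)
          where
          by-cases : Dec (Treated n - c) → Dec (Treated n + c) → g (pull w₁ (pull w₂ c)) ≡ solved c
          -- The two sign families share cells when b is 0 or when b and c agree up to sign. The
          -- second word is computed after the first, so on common cells it has the last say.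
          by-cases (yes ∈₋) _       = acts₂ c ∈₋
          by-cases (no ∉₋) (yes ∈₊) = trans (cong (g ∘ pull w₁) (fixes₂ c ∉₋)) (acts₁ c ∈₊)
          by-cases (no ∉₋) (no ∉₊)  = trans (cong (g ∘ pull w₁) (fixes₂ c ∉₋))
            (trans (cong g (fixes₁ c ∉₊)) (fromInj₂ (λ ∈₊ → contradiction ∈₊ ∉₊) hyp))

        settled′ : Settled (suc n) (g ∘ pull (w₁ ++ w₂))
        settled′ i s v w early with cover n i s v w early
        ... | inj₁ early′    = solves _ (inj₂ (settled i s v w early′))
        ... | inj₂ (+ , ∈₊) = solves _ (inj₁ ∈₊)
        ... | inj₂ (- , ∈₋) = trans (unfold _) (acts₂ _ ∈₋)

-- Slab turns as ω-sequences of basic twists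

-- Position k of a block of length ω belongs to the pair k / 2; the flag marks the second twist of
-- the pair.
halve : ℕ → ℕ × Bool
halve 0             = 0 , false
halve 1             = 0 , true
halve (suc (suc n)) = map₁ suc (halve n)

double : ℕ → ℕ
double zero    = zero
double (suc j) = suc (suc (double j))

halve-double : ∀ j → halve (double j) ≡ (j , false)
halve-double zero    = refl
halve-double (suc j) = cong (map₁ suc) (halve-double j)

halve-suc-double : ∀ j → halve (suc (double j)) ≡ (j , true)
halve-suc-double zero    = refl
halve-suc-double (suc j) = cong (map₁ suc) (halve-suc-double j)

data Parity : ℕ → Set where
  even : ∀ j → Parity (double j)
  odd  : ∀ j → Parity (suc (double j))

parity : ∀ n → Parity n
parity 0             = even 0
parity 1             = odd 0
parity (suc (suc n)) with parity n
... | even j = even (suc j)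
... | odd j  = odd (suc j)

double-cancel-≤ : ∀ m n → double m ℕ.≤ suc (double n) → m ℕ.≤ n
double-cancel-≤ zero    n       _             = z≤n
double-cancel-≤ (suc m) (suc n) (s≤s (s≤s p)) = s≤s (double-cancel-≤ m n p)

module Blocks (em : ∀ {a} → ExcludedMiddle a) {ℓ} (L : Set ℓ)
  (_≟_ : DecidableEquality L) (L⤖ℕ : L ⤖ ℕ) where
  open Cube L _≟_
  open Slabs L _≟_
  open Families L _≟_ using (faceCell-at)
  open Solving em L _≟_ L⤖ℕ

  powers : Axis → L̄† → BasicTwist → Set ℓ
  powers i α σ = σ ≡ T i α ⊎ σ ≡ T² i α ⊎ σ ≡ T³ i α

  single-in : ∀ i c → move (single i (c ! i)) c ≡ spin + i c
  single-in i c = move-in + i (is (c ! i)) c (is-refl (c ! i))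

  single-out : ∀ {i α c} → c ! i ≢ α → move (single i α) c ≡ c
  single-out {i} {α} {c} c≢α = move-out + i (is α) c (is-≢ c≢α)

  back-out : ∀ {i α σ c} → powers i α σ → c ! i ≢ α → back σ c ≡ c
  back-out {i} {α} {σ} {c} pow c≢α = trans (back-letters σ c) (by-cases pow)
    where
    once  = single-out {i} {α} {c} c≢α
    twice = trans (cong (move (single i α)) once) once
    by-cases : powers i α σ → pull (letters σ) c ≡ c
    by-cases (inj₁ refl)        = once
    by-cases (inj₂ (inj₁ refl)) = twice
    by-cases (inj₂ (inj₂ refl)) = trans (cong (move (single i α)) twice) once

  spin² spin³ : Axis → Cell → Cell
  spin² i c = spin + i (spin + i c)
  spin³ i c = spin + i (spin² i c)

  spin⁴ : ∀ i c → spin + i (spin³ i c) ≡ c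
  spin⁴ i c = trans (cong (spin + i) (spin-spin i c)) (spin-opposite + i c)

  on-slice : ∀ i {α c} → c ! i ≡ α → spin + i c ! i ≡ α
  on-slice i {c = c} p = trans (spin-coordinate + i c) p

  back-T : ∀ i {α c} → c ! i ≡ α → back (T i α) c ≡ spin + i c
  back-T i {c = c} refl = trans (back-letters (T i _) c) (single-in i c)

  back-T² : ∀ i {α c} → c ! i ≡ α → back (T² i α) c ≡ spin² i c
  back-T² i {α} {c} p = trans (cong (back (T i α)) (back-T i p)) (back-T i (on-slice i {α} {c} p))

  back-T³ : ∀ i {α c} → c ! i ≡ α → back (T³ i α) c ≡ spin³ i c
  back-T³ i {α} {c} p = trans (cong (back (T i α)) (back-T² i p))
    (back-T i (on-slice i {α} {spin + i c} (on-slice i {α} {c} p)))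

  -- No basic twist is trivial, so every slice is twisted twice, with the desired product.

  pair : Sign → Axis → L̄† → BasicTwist × BasicTwist
  pair + i α = T² i α , T³ i α
  pair - i α = T i α , T² i α

  idle : Axis → L̄† → BasicTwist × BasicTwist
  idle i α = T i α , T³ i α

  both : BasicTwist × BasicTwist → Cell → Cell
  both (σ , τ) c = back σ (back τ c)

  Powers : Axis → L̄† → BasicTwist × BasicTwist → Set ℓ
  Powers i α (σ , τ) = powers i α σ × powers i α τ

  pair-powers : ∀ d i α → Powers i α (pair d i α)
  pair-powers + i α = inj₂ (inj₁ refl) , inj₂ (inj₂ refl)
  pair-powers - i α = inj₁ refl , inj₂ (inj₁ refl)

  idle-powers : ∀ i α → Powers i α (idle i α)
  idle-powers i α = inj₁ refl , inj₂ (inj₂ refl)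

  both-out : ∀ {i α στ c} → Powers i α στ → c ! i ≢ α → both στ c ≡ c
  both-out {στ = σ , τ} (pow , pow′) c≢α =
    trans (cong (back σ) (back-out {σ = τ} pow′ c≢α)) (back-out {σ = σ} pow c≢α)

  spin³-slice : ∀ i {α c} → c ! i ≡ α → spin³ i c ! i ≡ α
  spin³-slice i {α} {c} p =
    on-slice i {α} {spin² i c} (on-slice i {α} {spin + i c} (on-slice i {α} {c} p))

  pair-in : ∀ d i {α c} → c ! i ≡ α → both (pair d i α) c ≡ spin d i c
  pair-in + i {α} {c} p = trans (cong (back (T² i α)) (back-T³ i p))
    (trans (back-T² i (spin³-slice i {α} {c} p)) (cong (spin + i) (spin⁴ i c)))
  pair-in - i {α} {c} p = trans (cong (back (T i α)) (back-T² i p))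
    (trans (back-T i (on-slice i {α} {spin + i c} (on-slice i {α} {c} p))) (spin-spin i c))

  idle-in : ∀ i {α c} → c ! i ≡ α → both (idle i α) c ≡ c
  idle-in i {α} {c} p = trans (cong (back (T i α)) (back-T³ i p))
    (trans (back-T i (spin³-slice i {α} {c} p)) (spin⁴ i c))

  idle-id : ∀ i α c → both (idle i α) c ≡ c
  idle-id i α c = by-cases ((c ! i) ≟̄ α)
    where
    by-cases : Dec (c ! i ≡ α) → both (idle i α) c ≡ c
    by-cases (yes p) = idle-in i p
    by-cases (no ¬p) = both-out {στ = idle i α} {c} (idle-powers i α) ¬p

  code : L̄† → ℕ
  code (fin 0†)           = 0
  code (∞ +)              = 1
  code (∞ -)              = 2
  code (fin (signed + a)) = 3 ℕ.+ double (index a)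
  code (fin (signed - a)) = 4 ℕ.+ double (index a)

  double-injective : ∀ m n → double m ≡ double n → m ≡ n
  double-injective m n e = cong proj₁ (trans (sym (halve-double m)) (trans (cong halve e) (halve-double n)))

  double≢ : ∀ m n → double m ≢ suc (double n)
  double≢ m n e with trans (sym (halve-double m)) (trans (cong halve e) (halve-suc-double n))
  ... | ()

  index-injective : ∀ {a a′} → index a ≡ index a′ → a ≡ a′
  index-injective = Bijection.injective L⤖ℕ

  code-injective : ∀ α β → code α ≡ code β → α ≡ β
  code-injective (fin 0†) (fin 0†) _ = refl
  code-injective (∞ +) (∞ +) _ = refl
  code-injective (∞ -) (∞ -) _ = refl
  code-injective (fin (signed + a)) (fin (signed + a′)) e =
    cong (fin ∘ signed +) (index-injective (double-injective _ _ (ℕ.+-cancelˡ-≡ 3 _ _ e)))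
  code-injective (fin (signed - a)) (fin (signed - a′)) e =
    cong (fin ∘ signed -) (index-injective (double-injective _ _ (ℕ.+-cancelˡ-≡ 4 _ _ e)))
  code-injective (fin (signed + a)) (fin (signed - a′)) e =
    contradiction (ℕ.+-cancelˡ-≡ 3 _ _ e) (double≢ _ _)
  code-injective (fin (signed - a)) (fin (signed + a′)) e =
    contradiction (ℕ.+-cancelˡ-≡ 3 _ _ (sym e)) (double≢ _ _)
  code-injective (fin 0†) (fin (signed + _)) ()
  code-injective (fin 0†) (fin (signed - _)) ()
  code-injective (fin 0†) (∞ +) ()
  code-injective (fin 0†) (∞ -) ()
  code-injective (∞ +) (fin 0†) ()
  code-injective (∞ +) (fin (signed + _)) ()
  code-injective (∞ +) (fin (signed - _)) ()
  code-injective (∞ +) (∞ -) ()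
  code-injective (∞ -) (fin 0†) ()
  code-injective (∞ -) (fin (signed + _)) ()
  code-injective (∞ -) (fin (signed - _)) ()
  code-injective (∞ -) (∞ +) ()
  code-injective (fin (signed + _)) (fin 0†) ()
  code-injective (fin (signed + _)) (∞ +) ()
  code-injective (fin (signed + _)) (∞ -) ()
  code-injective (fin (signed - _)) (fin 0†) ()
  code-injective (fin (signed - _)) (∞ +) ()
  code-injective (fin (signed - _)) (∞ -) ()

  -- After n twists a configuration g has become g ∘ `prefix σ n`. The latest twist meets the cell
  -- first, since twists act by precomposition.
  prefix : (ℕ → BasicTwist) → ℕ → Cell → Cell
  prefix σ zero    c = c
  prefix σ (suc n) c = prefix σ n (back (σ n) c)

  module Stream (n : ℕ) (d : Sign) (i : Axis) (E : L̄† → Bool) where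

    -- The idle slices recede from the low ones and from each other.

    padding : ℕ → L̄†
    padding j = fin (signed + (element (n ℕ.+ j)))

    slot? : ∀ j → Dec (∃[ α ] code α ≡ j × E α ≡ true)
    slot? j = em

    twists : ℕ → BasicTwist × BasicTwist
    twists j with slot? j
    ... | yes (α , _) = pair d i α
    ... | no _        = idle i (padding j)

    choose : ℕ × Bool → BasicTwist
    choose (j , false) = proj₁ (twists j)
    choose (j , true)  = proj₂ (twists j)

    stream : ℕ → BasicTwist
    stream k = choose (halve k)

    twists-at : ∀ j c → code (c ! i) ≡ j → both (twists j) c ≡ move (d , i , E) c
    twists-at j c code≡j with slot? j
    ... | yes (α , e , Eα) with code-injective α (c ! i) (trans e (sym code≡j))
    ...   | refl = trans (pair-in d i refl) (sym (move-in d i E c Eα))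
    twists-at j c code≡j | no ¬slot = trans (idle-id i (padding j) c) (sym (move-out d i E c out))
      where
      out : E (c ! i) ≡ false
      out with E (c ! i) in e
      ... | true  = contradiction (_ , code≡j , e) ¬slot
      ... | false = refl

    twists-off : ∀ j c → code (c ! i) ≢ j → both (twists j) c ≡ c
    twists-off j c code≢j with slot? j
    ... | yes (α , e , _) = both-out (pair-powers d i α) λ c≡α → code≢j (trans (cong code c≡α) e)
    ... | no _            = idle-id i (padding j) c

    bound : L̄† → ℕ
    bound (∞ _)   = 0
    bound (fin v) = rank v

    -- Even an idle pair disturbs its slice halfway, so convergence needs that a cell meets only
    -- finitely many pairs. An active slice is met at its code only, and the padding of pair j has
    -- rank n + j + 1, beyond the coordinate of c.
    first-off : ∀ j c → code (c ! i) ℕ.< j → bound (c ! i) ℕ.≤ j → back (proj₁ (twists j)) c ≡ c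
    first-off j c code< bound≤ with slot? j
    ... | yes (α , e , _) = back-out {σ = proj₁ (pair d i α)} (proj₁ (pair-powers d i α))
      λ c≡α → ℕ.<⇒≢ code< (trans (cong code c≡α) e)
    ... | no _ = back-out {σ = T i (padding j)} (inj₁ refl) λ c≡pad → ℕ.<⇒≱
      (s≤s (ℕ.m≤n+m j n)) (subst (ℕ._≤ j)
        (trans (cong bound c≡pad) (cong suc (index-element (n ℕ.+ j)))) bound≤)

    prefix-two : ∀ j c → prefix stream (double (suc j)) c ≡ prefix stream (double j) (both (twists j) c)
    prefix-two j c rewrite halve-double j | halve-suc-double j = refl

    prefix-before : ∀ j c → j ℕ.≤ code (c ! i) → prefix stream (double j) c ≡ c
    prefix-before zero    c _  = refl
    prefix-before (suc j) c j< = trans (prefix-two j c) (trans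
      (cong (prefix stream (double j)) (twists-off j c (≢-sym (ℕ.<⇒≢ j<))))
      (prefix-before j c (ℕ.<⇒≤ j<)))

    prefix-after : ∀ j c → code (c ! i) ℕ.< j → prefix stream (double j) c ≡ move (d , i , E) c
    prefix-after (suc j) c (s≤s code≤) with ℕ.m≤n⇒m<n∨m≡n code≤
    ... | inj₁ code< = trans (prefix-two j c) (trans
      (cong (prefix stream (double j)) (twists-off j c (ℕ.<⇒≢ code<))) (prefix-after j c code<))
    ... | inj₂ code≡ = trans (prefix-two j c) (trans
      (cong (prefix stream (double j)) (twists-at j c code≡))
      (prefix-before j _ (ℕ.≤-reflexive (sym (trans (cong code (move-coordinate d i E c)) code≡)))))

    converges : ∀ c → ∃[ N ] ∀ k → N ℕ.≤ k → prefix stream k c ≡ move (d , i , E) c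
    converges c = double N , λ k N≤k → by-parity (parity k) N≤k
      where
      N = suc (code (c ! i)) ℕ.⊔ bound (c ! i)
      code<N  = ℕ.m≤m⊔n (suc (code (c ! i))) (bound (c ! i))
      bound≤N = ℕ.m≤n⊔m (suc (code (c ! i))) (bound (c ! i))
      by-parity : ∀ {k} → Parity k → double N ℕ.≤ k → prefix stream k c ≡ move (d , i , E) c
      by-parity (even j) N≤k = prefix-after j c
        (ℕ.≤-trans code<N (double-cancel-≤ N j (ℕ.m≤n⇒m≤1+n N≤k)))
      by-parity (odd j) N≤k = trans
        (cong (prefix stream (double j)) (trans (cong (λ p → back (choose p) c) (halve-double j))
          (first-off j c (ℕ.≤-trans code<N N≤j) (ℕ.≤-trans bound≤N N≤j))))
        (prefix-after j c (ℕ.≤-trans code<N N≤j))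
        where N≤j = double-cancel-≤ N j N≤k

    High : L̄† → Set ℓ
    High α = ∀ v → Low n v → α ≢ fin v

    High-twist : BasicTwist → Set ℓ
    High-twist σ = ∃[ α ] High α × powers i α σ

    twists-high : Polite n (d , i , E) → ∀ j →
      High-twist (proj₁ (twists j)) × High-twist (proj₂ (twists j))
    twists-high polite j with slot? j
    ... | yes (α , _ , Eα) = (α , high , proj₁ (pair-powers d i α)) , (α , high , proj₂ (pair-powers d i α))
      where
      high : High α
      high v low refl with trans (sym Eα) (polite v low)
      ... | ()
    ... | no _ = (padding j , high , inj₁ refl) , (padding j , high , inj₂ (inj₂ refl))
      where
      high : High (padding j)
      high v low refl = ℕ.<-asym low (s≤s (subst (n ℕ.≤_) (sym (index-element (n ℕ.+ j))) (ℕ.m≤m+n n j)))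

    stream-high : Polite n (d , i , E) → ∀ k → High-twist (stream k)
    stream-high polite k with halve k
    ... | j , false = proj₁ (twists-high polite j)
    ... | j , true  = proj₂ (twists-high polite j)

-- The run of length ω²

module Schedule (em : ∀ {a} → ExcludedMiddle a) {ℓ} (L : Set ℓ)
  (_≟_ : DecidableEquality L) (L⤖ℕ : L ⤖ ℕ) where
  open Cube L _≟_
  open Slabs L _≟_
  open Solving em L _≟_ L⤖ℕ
  open Blocks em L _≟_ L⤖ℕ

  -- Both finite coordinates are low, whereas `Early` asks for one. A cell with a single low
  -- coordinate is solved between levels, yet the slice of its other coordinate may still carry it
  -- away during a level.
  LowFace : ℕ → Axis → Sign → Cell → Set ℓ
  LowFace n i s c = ∃[ v ] ∃[ w ] Low n v × Low n w × c ≡ faceCell i s v w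

  module _ {n : ℕ} {i : Axis} {s : Sign} where

    spin+-low : ∀ {c} → LowFace n i s c → LowFace n i s (spin + i c)
    spin+-low (v , w , v-low , w-low , refl) =
      w , neg† v , w-low , subst (ℕ._< n) (sym (rank-neg v)) v-low , spin-same i

    spin-low : ∀ d {c} → LowFace n i s c → LowFace n i s (spin d i c)
    spin-low + low = spin+-low low
    spin-low - {c} low = subst (LowFace n i s) (spin-spin i c) (spin+-low (spin+-low (spin+-low low)))

    low-slice : ∀ j {c} → LowFace n i s c → (∀ v → Low n v → c ! j ≢ fin v) → j ≡ i
    low-slice j (v , w , v-low , w-low , refl) high with relative i j
    ... | same   = refl
    ... | after  = contradiction (face-next i) (high v v-low)
    ... | before = contradiction (face-prev i) (high w w-low)

    low-solved : ∀ {c c′} → LowFace n i s c → LowFace n i s c′ → solved c ≡ solved c′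
    low-solved (_ , _ , _ , _ , refl) (_ , _ , _ , _ , refl) = solved-face i

    move-low : ∀ l → Polite n l → ∀ {c} → LowFace n i s c → LowFace n i s (move l c)
    move-low (d , j , E) polite {c} low with E (c ! j) in e
    ... | false = subst (LowFace n i s) (sym (move-out d j E c e)) low
    ... | true  = subst (LowFace n i s) (sym (move-in d j E c e))
      (subst (λ j → LowFace n i s (spin d j c)) (sym (low-slice j low high)) (spin-low d low))
      where
      high : ∀ v → Low n v → c ! j ≢ fin v
      high v v-low e′ with trans (sym e) (trans (cong E e′) (polite v v-low))
      ... | ()

    powers-low : ∀ {j α σ} → powers j α σ → (∀ v → Low n v → α ≢ fin v) →
      ∀ {c} → LowFace n i s c → LowFace n i s (back σ c)
    powers-low {j} {α} {σ} pow high {c} low = by-cases ((c ! j) ≟̄ α)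
      where
      on-slice-low : powers j α σ → c ! j ≡ α → j ≡ i → LowFace n i s (back σ c)
      on-slice-low (inj₁ refl) p refl = subst (LowFace n i s) (sym (back-T j p)) (spin+-low low)
      on-slice-low (inj₂ (inj₁ refl)) p refl =
        subst (LowFace n i s) (sym (back-T² j p)) (spin+-low (spin+-low low))
      on-slice-low (inj₂ (inj₂ refl)) p refl =
        subst (LowFace n i s) (sym (back-T³ j p)) (spin+-low (spin+-low (spin+-low low)))
      by-cases : Dec (c ! j ≡ α) → LowFace n i s (back σ c)
      by-cases (yes p) = on-slice-low pow p (low-slice j low λ v v-low e → high v v-low (trans (sym p) e))
      by-cases (no ¬p) = subst (LowFace n i s) (sym (back-out {σ = σ} pow ¬p)) low

    prefix-low : ∀ d j E → Polite n (d , j , E) → ∀ k {c} →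
      LowFace n i s c → LowFace n i s (prefix (Stream.stream n d j E) k c)
    prefix-low d j E polite zero    low = low
    prefix-low d j E polite (suc k) low with Stream.stream-high n d j E polite k
    ... | _ , high , pow = prefix-low d j E polite k (powers-low pow high low)

  -- A moment between two slab turns. In the middle of a level `Settled` is lost and only promised
  -- again by `goal`; `kept` is the part of it that survives every turn and yields convergence at
  -- ω².
  record State : Set ℓ where
    constructor state
    field
      level  : ℕ
      now    : Configuration
      rest   : Word
      local  : Local now
      kept   : ∀ {i s c} → LowFace level i s c → now c ≡ solved c
      polite : All (Polite level) rest
      goal   : Settled (suc level) (now ∘ pull rest)
  open State

  -- When the word is used up, the empty slab is turned: this block consists of idle pairs only, and
  -- meanwhile the next level is planned.
  letter : State → Letter
  letter S with rest S
  ... | []    = + , x-axis , const false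
  ... | l ∷ _ = l

  letter-polite : ∀ S → Polite (level S) (letter S)
  letter-polite S with rest S | polite S
  ... | []    | _     = λ _ _ → refl
  ... | _ ∷ _ | p ∷ _ = p

  advance : State → State
  advance (state n g []      loc kept _ goal) = let w , polite , goal′ = stage (suc n) g loc goal in
    state (suc n) g w loc
      (λ { {i} {s} (v , w , v-low , _ , refl) → goal i s v w (lowˡ v-low) }) polite goal′
  -- The head of a word is the outermost factor of `pull`, hence the first turn in time.
  advance (state n g (l ∷ w) loc kept (p ∷ polite) goal) =
    state n (g ∘ move l) w (local-pull g (l ∷ []) loc)
      (λ low → let low′ = move-low l p low in trans (kept low′) (low-solved low′ low)) polite goal

  now-advance : ∀ S c → now (advance S) c ≡ now S (move (letter S) c)
  now-advance (state n g []      loc kept _ goal) c = cong g (sym (move-out + x-axis (const false) c refl))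
  now-advance (state n g (l ∷ w) loc kept (p ∷ polite) goal) c = refl

  level-advance : ∀ S → level S ℕ.≤ level (advance S)
  level-advance (state n g []      loc kept _ goal) = ℕ.n≤1+n n
  level-advance (state n g (l ∷ w) loc kept (p ∷ polite) goal) = ℕ.≤-refl

  initial : ∀ f → Local f → State
  initial f loc = start (loc 0† 0†)
    where
    start : ∃[ w₀ ] (∀ m → f (embed 0† 0† m) ≡ solved (pull w₀ (embed 0† 0† m))) → State
    start (w₀ , centres) =
      let w , _ , goal = stage 0 (f ∘ pull (inverse w₀)) (local-pull f (inverse w₀) loc) centred in
      -- No slice is low at level 0, so the word for the centres may turn arbitrary slices and can
      -- be prepended to the first level.
      state 0 f (inverse w₀ ++ w) loc (λ { (_ , _ , () , _) }) (All.universal (λ _ _ ()) _)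
        λ i s v w′ early → trans (cong f (pull-++ (inverse w₀) w _)) (goal i s v w′ early)
      where
      centred : Settled 0 (f ∘ pull (inverse w₀))
      centred i s _ _ (central refl refl) =
        let m , e = pull-embed 0† 0† (inverse w₀) (frame i + s +) in trans (cong f e)
          (trans (centres m) (cong solved (trans (cong (pull w₀) (sym e)) (pull-inverseʳ w₀ _))))

  module Progress (S₀ : State) where

    states : ℕ → State
    states zero    = S₀
    states (suc k) = advance (states k)

    level-mono : ∀ {j k} → j ℕ.≤ k → level (states j) ℕ.≤ level (states k)
    level-mono {j} j≤k with ℕ.≤⇒≤′ j≤k
    ... | p = go p
      where
      go : ∀ {k} → j ℕ.≤′ k → level (states j) ℕ.≤ level (states k)
      go ℕ.≤′-refl     = ℕ.≤-refl
      go (ℕ.≤′-step {k} p) = ℕ.≤-trans (go p) (level-advance (states k))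

    next-level : ∀ k w → rest (states k) ≡ w → ∃[ k′ ] suc (level (states k)) ℕ.≤ level (states k′)
    next-level k w e = go k w (states k) refl e
      where
      go : ∀ k w S → states k ≡ S → rest S ≡ w → ∃[ k′ ] suc (level S) ℕ.≤ level (states k′)
      go k [] S@(state _ _ .[] _ _ _ _) eq refl =
        suc k , subst (λ S′ → suc (level S) ℕ.≤ level (advance S′)) (sym eq) ℕ.≤-refl
      go k (l ∷ w) S@(state _ _ .(l ∷ w) _ _ (_ ∷ _) _) eq refl =
        go (suc k) w (advance S) (cong advance eq) refl

    reaches : ∀ N → ∃[ k ] N ℕ.≤ level (states k)
    reaches zero    = 0 , z≤n
    reaches (suc N) with reaches N
    ... | k , N≤ with next-level k _ refl
    ...   | k′ , k<k′ = k′ , ℕ.≤-trans (s≤s N≤) k<k′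

    twistsOf : State → ℕ → BasicTwist
    twistsOf S = let d , i , E = letter S in Stream.stream (level S) d i E

    -- The configuration at stage ω · k + n. Block k tends to a single slab turn, and block k + 1
    -- starts from its exact result.
    course : ℕ → ℕ → Configuration
    course k n = now (states k) ∘ prefix (twistsOf (states k)) n

    course-limit : ∀ k c → ∃[ N ] ∀ n → N ℕ.≤ n → course k n c ≡ course (suc k) 0 c
    course-limit k c with Stream.converges (level (states k)) (proj₁ (letter (states k)))
      (proj₁ (proj₂ (letter (states k)))) (proj₂ (proj₂ (letter (states k)))) c
    ... | N , conv = N , λ n N≤n →
      trans (cong (now (states k)) (conv n N≤n)) (sym (now-advance (states k) c))

    course-solved : ∀ c → ∃[ K ] ∀ k → K ℕ.≤ k → ∀ n → course k n c ≡ solved c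
    course-solved c with faceView c
    ... | face i s v w = K , λ k K≤k n →
      let N≤ = ℕ.≤-trans N≤K (level-mono K≤k)
          low = v , w , ℕ.≤-trans (s≤s (ℕ.m≤m⊔n (rank v) (rank w))) N≤
                      , ℕ.≤-trans (s≤s (ℕ.m≤n⊔m (rank v) (rank w))) N≤ , refl
          d , j , E = letter (states k)
          low′ = prefix-low d j E (letter-polite (states k)) n low
      in trans (kept (states k) low′) (low-solved low′ low)
      where
      K = proj₁ (reaches (suc (rank v ℕ.⊔ rank w)))
      N≤K = proj₂ (reaches (suc (rank v ℕ.⊔ rank w)))

    open Stages ω²

    plan : BasicSequence ω²
    plan (k , n) = twistsOf (states k) n

    at : Stage → Configuration
    at [ k , n ] = course k n
    at ⊤⁺        = solved

    n<1+n : ∀ {k n} → [ k , n ] <⁺ [ k , suc n ]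
    n<1+n = [ inj₂ (refl , ℕ.n<1+n _) ]

    <⇒≤-suc : ∀ {k n k′ n′} → [ k , n ] <⁺ [ k′ , n′ ] →
      [ k , suc n ] <⁺ [ k′ , n′ ] ⊎ (k′ , n′) ≡ (k , suc n)
    <⇒≤-suc [ inj₁ k<k′ ] = inj₁ [ inj₁ k<k′ ]
    <⇒≤-suc [ inj₂ (refl , n<n′) ] with ℕ.m≤n⇒m<n∨m≡n n<n′
    ... | inj₁ 1+n<n′ = inj₁ [ inj₂ (refl , 1+n<n′) ]
    ... | inj₂ refl   = inj₂ refl

    -- Serves both limit clauses of a run: any eventual value must agree with the one found here,
    -- and the case of NaC never arises. The genuine limits are ω · (k + 1), by convergence of block
    -- k, and ω², by the growth of the levels.
    settles : ∀ η → IsLimit η → ∀ c →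
      ∃[ ζ ] ζ <⁺ η × (∀ ξ → ζ <⁺ ξ → ξ <⁺ η → at ξ c ≡ at η c)
    settles ⊤⁺ _ c with course-solved c
    ... | K , stable = [ K , 0 ] , [ _ ]<⊤⁺ , λ
      { [ k , n ] [ inj₁ K<k ] _ → stable k (ℕ.<⇒≤ K<k) n
      ; [ k , n ] [ inj₂ (refl , _) ] _ → stable k ℕ.≤-refl n }
    settles [ zero , zero ] (¬zero , _) c = contradiction
      (λ { [ _ , _ ] [ inj₁ () ] ; [ _ , _ ] [ inj₂ (_ , ()) ] }) ¬zero
    settles [ suc k , zero ] _ c with course-limit k c
    ... | N , conv = [ k , N ] , [ inj₁ (ℕ.n<1+n k) ] , λ
      { [ k′ , n ] [ inj₁ k<k′ ] [ inj₁ k′<1+k ] → contradiction k′<1+k (ℕ.≤⇒≯ k<k′)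
      ; [ k′ , n ] [ inj₂ (refl , N<n) ] _ → conv n (ℕ.<⇒≤ N<n)
      ; [ k′ , n ] _ [ inj₂ (_ , ()) ] }
    settles [ k , suc n ] (_ , dense) c with dense [ k , n ] n<1+n
    ... | [ k′ , n′ ] , lt , lt′ with <⇒≤-suc lt
    ...   | inj₂ refl = contradiction lt′ λ
      { [ inj₁ k<k ] → ℕ.<-irrefl refl k<k ; [ inj₂ (_ , n<n) ] → ℕ.<-irrefl refl n<n }
    ...   | inj₁ lt″ = contradiction (lt″ , lt′) λ
      { ([ inj₁ a ] , [ inj₁ b ]) → ℕ.<-asym a b
      ; ([ inj₁ a ] , [ inj₂ (refl , _) ]) → ℕ.<-irrefl refl a
      ; ([ inj₂ (refl , _) ] , [ inj₁ b ]) → ℕ.<-irrefl refl b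
      ; ([ inj₂ (refl , a) ] , [ inj₂ (_ , b) ]) → ℕ.<-asym a b }

    zero-stage : ∀ η → IsZero η → at η ≗ now S₀
    zero-stage ⊤⁺               isZero _ = contradiction [ _ ]<⊤⁺ (isZero [ 0 , 0 ])
    zero-stage [ zero , zero ]  isZero _ = refl
    zero-stage [ suc k , n ]    isZero _ = contradiction [ inj₁ (s≤s z≤n) ] (isZero [ 0 , 0 ])
    zero-stage [ zero , suc n ] isZero _ =
      contradiction [ inj₂ (refl , s≤s z≤n) ] (isZero [ 0 , 0 ])

    successor-stage : ∀ ζ η → IsSuccessorOf ζ η → at η ≗ twist (plan ζ) (at [ ζ ])
    successor-stage (k , n) ⊤⁺ (_ , none) _ =
      contradiction (n<1+n , [ _ ]<⊤⁺) (none [ k , suc n ])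
    successor-stage (k , n) [ k′ , n′ ] (lt , none) _ with <⇒≤-suc lt
    ... | inj₁ lt′  = contradiction (n<1+n , lt′) (none [ k , suc n ])
    ... | inj₂ refl = refl

    limit-stage : ∀ η → IsLimit η → ∀ c v → Eventually ω² at η c v → at η c ≡ v
    limit-stage η isLimit c v (ζ , ζ<η , _ , eventually) =
      let ζ′ , ζ′<η , settled = settles η isLimit c
          ξ , ζ<ξ , ζ′<ξ , ξ<η = StageProperties.common-bound ω² isLimit ζ<η ζ′<η
      in trans (sym (settled ξ ζ′<ξ ξ<η)) (eventually ξ ζ<ξ ξ<η)

    limit-value : ∀ η → IsLimit η → ∀ c → ∃ (Eventually ω² at η c)
    limit-value η isLimit c =
      let ζ , ζ<η , settled = settles η isLimit c
          ξ , ζ<ξ , _ , ξ<η = StageProperties.common-bound ω² isLimit ζ<η ζ<η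
      in at η c , ξ , ξ<η , settled ξ ζ<ξ ξ<η
       , λ ξ′ ξ<ξ′ → settled ξ′ (StageProperties.<⁺-transitive ω² ζ<ξ ξ<ξ′)

    run : Run ω² plan (now S₀) solved
    run = record
      { at        = at
      ; zero      = zero-stage
      ; successor = successor-stage
      ; limit     = limit-stage
      ; limit-NaC = λ η isLimit c none → contradiction (limit-value η isLimit c) none
      ; terminal  = λ _ → refl
      }

-- Accessible configurations

module StageCases (em : ∀ {a} → ExcludedMiddle a) {o r} (θ : Ordinal o r) where
  open Ordinal θ
  open Stages θ

  data StageCase (η : Stage) : Set (o ⊔ r) where
    is-zero      : IsZero η → StageCase η
    is-successor : ∀ ζ → IsSuccessorOf ζ η → StageCase η
    is-limit     : IsLimit η → StageCase η

  stageCase : ∀ η → StageCase η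
  stageCase η with em {P = IsZero η} | em {P = ∃[ ζ ] IsSuccessorOf ζ η}
  ... | yes isZero | _              = is-zero isZero
  ... | no _       | yes (ζ , succ) = is-successor ζ succ
  ... | no ¬zero   | no ¬succ       = is-limit (¬zero , dense)
    where
    dense : ∀ ζ → ζ <⁺ η → ∃[ ξ ] ζ <⁺ ξ × ξ <⁺ η
    dense ζ ζ<η with em {P = ∃[ ξ ] ζ <⁺ ξ × ξ <⁺ η}
    dense ζ     ζ<η | yes found = found
    dense [ k ] ζ<η | no none   = contradiction (k , ζ<η , λ ξ between → none (ξ , between)) ¬succ
    dense ⊤⁺    ()  | no none

module Analysis (em : ∀ {a} → ExcludedMiddle a) {ℓ} (L : Set ℓ) (_≟_ : DecidableEquality L)
  {o r} (θ : Ordinal o r) where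
  open Cube L _≟_
  open Slabs L _≟_
  open Stages θ
  open StageProperties θ
  open StageCases em θ

  module _ {σ : BasicSequence θ} {f : Configuration} (run : Run θ σ solved f) (b c : L†) where
    open Run run

    Scrambled : Stage → Set ℓ
    Scrambled η = ∃[ w ] ∀ m → at η (embed b c m) ≡ solved (pull w (embed b c m))

    Spoilt : Stage → Set
    Spoilt η = ∃[ m ] at η (embed b c m) ≡ NaC

    twisted : ∀ {ζ η} → IsSuccessorOf ζ η → Scrambled [ ζ ] ⊎ Spoilt [ ζ ] → Scrambled η ⊎ Spoilt η
    twisted {ζ} {η} succ (inj₁ (w , scrambled)) = inj₁ (w ++ letters (σ ζ) , λ m →
      let x = embed b c m ; m′ , ahead = pull-embed b c (letters (σ ζ)) m in begin
      at η x                                ≡⟨ successor ζ η succ x ⟩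
      at [ ζ ] (back (σ ζ) x)               ≡⟨ cong (at [ ζ ]) (trans (back-letters (σ ζ) x) ahead) ⟩
      at [ ζ ] (embed b c m′)               ≡⟨ scrambled m′ ⟩
      solved (pull w (embed b c m′))        ≡⟨ cong (solved ∘ pull w) ahead ⟨
      solved (pull w (pull (letters (σ ζ)) x)) ≡⟨ cong solved (pull-++ w _ x) ⟨
      solved (pull (w ++ letters (σ ζ)) x)  ∎)
      where open ≡-Reasoning
    twisted {ζ} {η} succ (inj₂ (m , spoilt)) =
      let w = letters (σ ζ) ; m′ , behind = pull-embed b c (inverse w) m in inj₂ (m′ , (begin
      at η (embed b c m′)                       ≡⟨ successor ζ η succ _ ⟩
      at [ ζ ] (back (σ ζ) (embed b c m′))      ≡⟨ cong (at [ ζ ]) (back-letters (σ ζ) _) ⟩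
      at [ ζ ] (pull w (embed b c m′))          ≡⟨ cong (at [ ζ ] ∘ pull w) behind ⟨
      at [ ζ ] (pull w (pull (inverse w) (embed b c m))) ≡⟨ cong (at [ ζ ]) (pull-inverseʳ w _) ⟩
      at [ ζ ] (embed b c m)                    ≡⟨ spoilt ⟩
      NaC                                       ∎))
      where open ≡-Reasoning

    -- A cluster is finite, so if all its cells settle then they do so at a common stage.

    settled-together : ∀ {η} → IsLimit η → (∀ m → ∃ (Eventually θ at η (embed b c m))) →
      ∀ ms → ∃[ ζ ] ζ <⁺ η ×
        (∀ {m} → m ∈ ms → ∀ ξ → ζ <⁺ ξ → ξ <⁺ η → at ξ (embed b c m) ≡ at η (embed b c m))
    settled-together {η} isLimit settles [] with settles (frame x-axis + + +)
    ... | _ , ζ , ζ<η , _ = ζ , ζ<η , λ ()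
    settled-together {η} isLimit settles (m ∷ ms) with settles m | settled-together isLimit settles ms
    ... | v , e@(ζ , ζ<η , _ , eventually) | ζ′ , ζ′<η , together =
      let ξ , ζ<ξ , ζ′<ξ , ξ<η = common-bound isLimit ζ<η ζ′<η in ξ , ξ<η , λ
      { (here refl) ξ′ ξ<ξ′ ξ′<η → trans (eventually ξ′ (<⁺-transitive ζ<ξ ξ<ξ′) ξ′<η)
                                         (sym (limit η isLimit _ v e))
      ; (there m∈ms) ξ′ ξ<ξ′ → together m∈ms ξ′ (<⁺-transitive ζ′<ξ ξ<ξ′) }

    at-limit : ∀ {η} → IsLimit η → (∀ {ξ} → ξ <⁺ η → Scrambled ξ ⊎ Spoilt ξ) →
      Dec (∃[ m ] ¬ ∃ (Eventually θ at η (embed b c m))) → Scrambled η ⊎ Spoilt η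
    at-limit {η} isLimit rec (yes (m , unsettled)) = inj₂ (m , limit-NaC η isLimit _ unsettled)
    at-limit {η} isLimit rec (no none)
      with settled-together isLimit (λ m → settled m em) frames
      where
      settled : ∀ m → Dec (∃ (Eventually θ at η (embed b c m))) → ∃ (Eventually θ at η (embed b c m))
      settled m (yes e) = e
      settled m (no ¬e) = contradiction (m , ¬e) none
    ... | ζ , ζ<η , together with common-bound isLimit ζ<η ζ<η
    ...   | ξ , ζ<ξ , _ , ξ<η with rec ξ<η
    ...     | inj₁ (w , scrambled) = inj₁ (w , λ m → trans (sym (together (∈-frames m) ξ ζ<ξ ξ<η)) (scrambled m))
    ...     | inj₂ (m , spoilt)    = inj₂ (m , trans (sym (together (∈-frames m) ξ ζ<ξ ξ<η)) spoilt)

    -- The dichotomy is a form of the persistence of NaC that transfinite induction can carry. A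
    -- twist permutes the cluster and so preserves either side. At a limit, either some cell has no
    -- eventual value and becomes NaC, or the cluster already shows its limit colours at an earlier
    -- stage and inherits from there.
    scrambled-or-spoilt : ∀ η → Scrambled η ⊎ Spoilt η
    scrambled-or-spoilt = WF.All.wfRec <⁺-wellFounded _ _ λ η rec → by-cases η rec (stageCase η)
      where
      by-cases : ∀ η → (∀ {ζ} → ζ <⁺ η → Scrambled ζ ⊎ Spoilt ζ) → StageCase η → Scrambled η ⊎ Spoilt η
      by-cases η rec (is-zero isZero)      = inj₁ ([] , λ m → Run.zero run η isZero _)
      by-cases η rec (is-successor ζ succ) = twisted succ (rec (proj₁ succ))
      by-cases η rec (is-limit isLimit)    = at-limit isLimit rec em

    accessible-scrambled : Legal f → ∃[ w ] ∀ m → f (embed b c m) ≡ solved (pull w (embed b c m))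
    accessible-scrambled legal with scrambled-or-spoilt ⊤⁺
    ... | inj₁ (w , scrambled) = w , λ m → trans (sym (terminal _)) (scrambled m)
    ... | inj₂ (m , spoilt)    = contradiction (trans (sym (terminal _)) spoilt) (legal _)

≼-refl : ∀ {o r} (θ : Ordinal o r) → θ ≼ θ
≼-refl θ = record { to = id ; monotone = id ; initial = λ y<x → _ , y<x , refl }

theorem5p7 : (∀ {a} → ExcludedMiddle a) →
    ∀ {ℓ o r} (L : Set ℓ) (L⤖ℕ : L ⤖ ℕ) →
    let open Cube L (countable⇒≟ L⤖ℕ) in
    (f : Configuration) → Legal f → Accessible o r solved f →
    Σ[ θ ∈ Ordinal 0ℓ 0ℓ ] θ ≼ ω² × (Σ[ σ ∈ BasicSequence θ ] Run θ σ f solved)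
theorem5p7 em L L⤖ℕ f legal (θ , σ , run) = ω² , ≼-refl ω² , plan , run′
  where
  open Schedule em L (countable⇒≟ L⤖ℕ) L⤖ℕ
  open Progress (initial f λ b c → Analysis.accessible-scrambled em L (countable⇒≟ L⤖ℕ) θ run b c legal)
    renaming (run to run′)
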